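{- For all $n \geq 0$, $$p_{\xi}(8n+6) \equiv 0 \pmod{4}\qquad\text{and}\qquad p_{\xi}(16n+10) \equiv 0 \pmod{4}.$$
   Context: $(a;q)_n=(1-a)(1-aq)\cdots(1-aq^{n-1})$, $(a;q)_0=1$. The coefficients $p_\xi(n)$ are defined by $\sum_{n\ge0}p_\xi(n)q^n=\xi(q)=1+2\sum_{n\ge1}\frac{q^{6n^2-6n+1}}{(q;q^6)_n(q^5;q^6)_n}$. -}

module Defs where

open import Data.Nat using (ℕ; zero; suc; _+_; _*_; _∸_; _≤?_)
open import Data.Nat.Divisibility using (_∣?_)
open import Data.Bool using (Bool; true; false; if_then_else_)
open import Relation.Nullary.Decidable using (does)

-- Formal power series in q with natural-number coefficients,
-- represented by their coefficient function.
PS : Set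
PS = ℕ → ℕ

sumTo : ℕ → (ℕ → ℕ) → ℕ
sumTo zero    f = f 0
sumTo (suc n) f = sumTo n f + f (suc n)

_⊛_ : PS → PS → PS
(f ⊛ g) m = sumTo m (λ i → f i * g (m ∸ i))

one : PS
one zero    = 1
one (suc _) = 0

-- 1/(1 - q^k) = Σ_{j ≥ 0} q^{k j}, for k ≥ 1 (geometric series expansion).
-- Coefficient of q^m is 1 if k ∣ m, else 0.
invOneMinus : ℕ → PS
invOneMinus k m = if does (k ∣? m) then 1 else 0

invPoch6 : ℕ → ℕ → PS
invPoch6 a zero    = one
invPoch6 a (suc n) = invPoch6 a n ⊛ invOneMinus (a + 6 * n)

shift : ℕ → PS → PS
shift s f m = if does (s ≤? m) then f (m ∸ s) else 0

-- The summand q^{6n²-6n+1} / ((q;q^6)_n (q^5;q^6)_n), for n ≥ 1.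
-- Written with n = k+1, so 6n²-6n+1 = 6k²+6k+1.
ξterm : ℕ → PS
ξterm k = shift (6 * k * k + 6 * k + 1) (invPoch6 1 (suc k) ⊛ invPoch6 5 (suc k))

-- p_ξ(m): coefficient of q^m in
--   ξ(q) = 1 + 2 Σ_{n≥1} q^{6n²-6n+1} / ((q;q^6)_n (q^5;q^6)_n).
-- The n-th summand is O(q^{6n²-6n+1}), so only n ≤ m+1 (k ≤ m) can contribute
-- to the coefficient of q^m; the infinite sum is therefore truncated exactly.
pξ : ℕ → ℕ
pξ m = one m + 2 * sumTo m (λ k → ξterm k m)

{-# OPTIONS --safe #-}

-- Modulo 4 only the parity of S = Σ_k q^(6k²+6k+1) / ((q;q⁶)_(k+1) (q⁵;q⁶)_(k+1)) matters, so S is taken in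
-- 𝔽₂[[q]]. Put Q = q⁶, p = 1/(Q;Q)_∞ and ψ = Σ_s Q^(s(s+1)/2). Expanding the summands of S in partial
-- fractions and summing with the Durfee rectangle identity gives S = p D with the Appell-Lerch sum
-- D = Σ_r q^(1+9r(r+1)) (1/(1-q^(6r+1)) + q^(6r+5)/(1-q^(6r+5))), and another case of the partial fractions
-- gives p = ψ p⁴. Hence S = (D ψ) p⁴, where p⁴ is a series in q²⁴. The coefficient of q^n in D ψ counts points
-- (a , z , X) with a ≡ ±1 (mod 6), z odd, on the conic n + 1 = 3z² + aX. If n ≡ 2 (mod 4) then 4 divides X,
-- and for a fixed X ≠ 0 the points cancel in pairs under z ↦ X - z and z ↦ z + X. Those with X = 0 remain, so
-- D ψ agrees with q² ψ⁴ at these exponents, and S with q² (ψ p)⁴ = q² (ψ p²)⁸, which lives on the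
-- exponents ≡ 2 (mod 48). Neither 8n + 6 nor 16n + 10 is ≡ 2 (mod 16).

module Submission where

open import Defs
open import Algebra.Bundles using (CommutativeRing; CommutativeSemiring; RawRing)
open import Algebra.Structures.Biased using (isCommutativeSemiringˡ)
open import Data.Bool.Base using (Bool; true; false; not; _xor_; _∧_; if_then_else_)
open import Data.Bool.Properties using
  ( xor-∧-commutativeRing; xor-assoc; xor-comm; xor-identityʳ; xor-same; ∧-assoc; ∧-comm; ∧-zeroʳ; ∧-identityʳ
  ; ∧-distribˡ-xor; ∧-distribʳ-xor; ¬-not; not-involutive )
open import Data.Nat as ℕ using (ℕ; zero; suc; s≤s; z≤n; _≤?_; _∸_)
open import Data.Nat.Divisibility using
  ( _∣_; _∣?_; _∣0; divides; ∣-refl; ∣-trans; ∣⇒≤; m∣m*n; n∣m*n; ∣n⇒∣m*n; *-monoʳ-∣; ∣m∣n⇒∣m+n; ∣m+n∣m⇒∣n; ∣m∸n∣n⇒∣m )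
open import Data.Nat.DivMod using (_%_; _/_; [m+kn]%n≡m%n; m≡m%n+[m/n]*n; /-monoˡ-≤)
import Data.Nat.Properties as ℕ
open import Data.Nat.Tactic.RingSolver using (solve-∀)
open import Data.Product using (∃; _×_; _,_; proj₁)
open import Data.Sum using (_⊎_; inj₁; inj₂)
open import Function.Base using (_∘_; id)
open import Function.Bundles using (_⇔_; mk⇔; Equivalence)
open import Level using (Level; 0ℓ)
open import Relation.Binary.Definitions using (tri<; tri≈; tri>)
open import Relation.Binary.PropositionalEquality as ≡ using (_≡_; cong; cong₂; subst)
open import Relation.Binary.Structures using (IsEquivalence)
open import Relation.Nullary.Decidable using (Dec; does; yes; no; dec-true; dec-false; does-⇔; from-no; map′; _×-dec_)
open import Relation.Nullary.Negation using (¬_; contradiction)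

-- The conic comes from completing the square. A term of D ψ has exponent n = ad + e(e+1) + 3s(s+1)
-- + ia with a = 2e + 1 and i ≥ 0; for z = e + s + 1 this reads n + 1 = 3z² + aX with X = a + d + i
-- - 3z. The symmetry s ↦ -1 - s of ψ replaces z by a - z, and exactly one of the two is odd, so odd
-- z select one representative for each s. What remains of i ≥ 0 is the inequality a + d ≤ X + 3z,
-- which breaks the symmetry of the conic. At fixed X > 0 it is multiplied by X, and aX = n + 1 -
-- 3z² is eliminated; it then concerns z alone and not the sign of a, so the classes a ≡ 1 and a ≡
-- -1 (mod 6) can be regrouped by signed a. The reflection z ↦ X - z keeps z odd only for even X and
-- has no odd fixed point when 4 divides X, which is where n ≡ 2 (mod 4) enters. Infinite sums and
-- products are avoided by computing modulo q^(N+1), where N is the coefficient wanted, and negative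
-- numbers by splitting the points into `Right?`, `Below?` and `Left?`.

triangle : ℕ → ℕ
triangle zero    = 0
triangle (suc n) = suc n ℕ.+ triangle n

triangle-≥ : ∀ n → n ℕ.≤ triangle n
triangle-≥ zero    = ℕ.z≤n
triangle-≥ (suc n) = ℕ.m≤m+n (suc n) (triangle n)

double-triangle : ∀ n → 2 ℕ.* triangle n ≡ n ℕ.* suc n
double-triangle zero    = ≡.refl
double-triangle (suc n) = ≡.trans (ℕ.*-distribˡ-+ 2 (suc n) _)
  (≡.trans (cong (2 ℕ.* suc n ℕ.+_) (double-triangle n)) (lem n))
  where
  lem : ∀ n → 2 ℕ.* suc n ℕ.+ n ℕ.* suc n ≡ suc n ℕ.* suc (suc n)
  lem = solve-∀

-- Finite Bailey-type identities in characteristic 2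

module Char2 {r ℓ : Level} (R : CommutativeSemiring r ℓ)
  (1+1≈0 : CommutativeSemiring._≈_ R
             (CommutativeSemiring._+_ R (CommutativeSemiring.1# R) (CommutativeSemiring.1# R))
             (CommutativeSemiring.0# R)) where

  open CommutativeSemiring R
  open import Algebra.Solver.Ring.AlmostCommutativeRing
    using (fromCommutativeSemiring; _-Raw-AlmostCommutative⟶_)
  open import Data.Maybe.Base using (Maybe; just; nothing)
  import Relation.Binary.Reasoning.Setoid setoid as ≈

  private
    𝔽₂ : RawRing 0ℓ 0ℓ
    𝔽₂ = record
      { Carrier = Bool ; _≈_ = _≡_ ; _+_ = _xor_ ; _*_ = _∧_ ; -_ = id ; 0# = false ; 1# = true }

    ⟦_⟧₂ : Bool → Carrier
    ⟦ true ⟧₂  = 1#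
    ⟦ false ⟧₂ = 0#

    morphism : 𝔽₂ -Raw-AlmostCommutative⟶ fromCommutativeSemiring R
    morphism = record
      { ⟦_⟧    = ⟦_⟧₂
      ; +-homo = λ { true true → sym 1+1≈0 ; true false → sym (+-identityʳ 1#) ; false b → sym (+-identityˡ ⟦ b ⟧₂) }
      ; *-homo = λ { true b → sym (*-identityˡ ⟦ b ⟧₂) ; false b → sym (zeroˡ ⟦ b ⟧₂) }
      ; -‿homo = λ _ → refl
      ; 0-homo = refl
      ; 1-homo = refl
      }

    _≟₂_ : (a b : Bool) → Maybe (⟦ a ⟧₂ ≈ ⟦ b ⟧₂)
    true  ≟₂ true  = just refl
    false ≟₂ false = just refl
    _     ≟₂ _     = nothing

  open import Algebra.Solver.Ring 𝔽₂ (fromCommutativeSemiring R) morphism _≟₂_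
    using (solve; _:=_; _:+_; _:*_; con) public

  -- Summing over pairs i + j = n keeps `n ∸ i` out of the summands. The recursion removes the end i
  -- = 0, and `antidiagonal-last` the end j = 0.
  antidiagonal : ℕ → (ℕ → ℕ → Carrier) → Carrier
  antidiagonal zero    f = f 0 0
  antidiagonal (suc n) f = f 0 (suc n) + antidiagonal n (λ i j → f (suc i) j)

  antidiagonal-cong : ∀ n {f g} → (∀ i j → i ℕ.+ j ≡ n → f i j ≈ g i j) → antidiagonal n f ≈ antidiagonal n g
  antidiagonal-cong zero    h = h 0 0 ≡.refl
  antidiagonal-cong (suc n) h = +-cong (h 0 (suc n) ≡.refl)
    (antidiagonal-cong n λ i j eq → h (suc i) j (≡.cong suc eq))

  antidiagonal-+ : ∀ n f g → antidiagonal n (λ i j → f i j + g i j) ≈ antidiagonal n f + antidiagonal n g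
  antidiagonal-+ zero    f g = refl
  antidiagonal-+ (suc n) f g = trans (+-congˡ (antidiagonal-+ n _ _))
    (solve 4 (λ a b c d → (a :+ b) :+ (c :+ d) := (a :+ c) :+ (b :+ d)) refl _ _ _ _)

  antidiagonal-*ˡ : ∀ n x f → antidiagonal n (λ i j → x * f i j) ≈ x * antidiagonal n f
  antidiagonal-*ˡ zero    x f = refl
  antidiagonal-*ˡ (suc n) x f = trans (+-congˡ (antidiagonal-*ˡ n x _)) (sym (distribˡ x _ _))

  antidiagonal-last : ∀ n f → antidiagonal (suc n) f ≈ antidiagonal n (λ i j → f i (suc j)) + f (suc n) 0
  antidiagonal-last zero    f = refl
  antidiagonal-last (suc n) f = trans (+-congˡ (antidiagonal-last n (λ i j → f (suc i) j))) (sym (+-assoc _ _ _))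

  antidiagonal-assoc : ∀ n (f : ℕ → ℕ → ℕ → Carrier) →
    antidiagonal n (λ m l → antidiagonal m (λ i j → f i j l))
      ≈ antidiagonal n (λ i m → antidiagonal m (λ j l → f i j l))
  antidiagonal-assoc zero    f = refl
  antidiagonal-assoc (suc n) f = begin
    f 0 0 (suc n) + antidiagonal n (λ m l → f 0 (suc m) l + antidiagonal m (λ i j → f (suc i) j l))
      ≈⟨ +-congˡ (antidiagonal-+ n _ _) ⟩
    f 0 0 (suc n) + (antidiagonal n (λ m l → f 0 (suc m) l) + antidiagonal n
      (λ m l → antidiagonal m (λ i j → f (suc i) j l)))
      ≈⟨ sym (+-assoc _ _ _) ⟩
    antidiagonal (suc n) (λ j l → f 0 j l) + antidiagonal n (λ m l → antidiagonal m (λ i j → f (suc i) j l))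
      ≈⟨ +-congˡ (antidiagonal-assoc n (λ i → f (suc i))) ⟩
    antidiagonal (suc n) (λ j l → f 0 j l) + antidiagonal n (λ i m → antidiagonal m (λ j l → f (suc i) j l)) ∎
    where open ≈

  range-sum : ℕ → (ℕ → Carrier) → Carrier
  range-sum zero    f = f 0
  range-sum (suc n) f = range-sum n f + f (suc n)

  antidiagonal-fst : ∀ n f → antidiagonal n (λ i _ → f i) ≈ range-sum n f
  antidiagonal-fst zero    f = refl
  antidiagonal-fst (suc n) f = trans (antidiagonal-last n (λ i _ → f i)) (+-congʳ (antidiagonal-fst n f))

  range-sum-*ˡ : ∀ n x f → range-sum n (λ i → x * f i) ≈ x * range-sum n f
  range-sum-*ˡ zero    x f = refl
  range-sum-*ˡ (suc n) x f = trans (+-congʳ (range-sum-*ˡ n x f)) (sym (distribˡ x _ _))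

  range-sum-cong : ∀ n {f g} → (∀ i → f i ≈ g i) → range-sum n f ≈ range-sum n g
  range-sum-cong zero    h = h 0
  range-sum-cong (suc n) h = +-cong (range-sum-cong n h) (h (suc n))

  module Bailey
    (pw : ℕ → Carrier) (pw-0 : pw 0 ≈ 1#) (pw-+ : ∀ m n → pw (m ℕ.+ n) ≈ pw m * pw n)
    (p : ℕ → Carrier) (p-0 : p 0 ≈ 1#) (p-suc : ∀ n → (1# + pw (suc n)) * p (suc n) ≈ p n)
    where

    open ≈

    e : ℕ → Carrier
    e n = 1# + pw n

    T : ℕ → Carrier
    T n = pw (triangle n)

    pw-≡ : ∀ {m n} → m ≡ n → pw m ≈ pw n
    pw-≡ ≡.refl = refl

    p-≡ : ∀ {m n} → m ≡ n → p m ≈ p n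
    p-≡ ≡.refl = refl

    e-≡ : ∀ {m n} → m ≡ n → e m ≈ e n
    e-≡ ≡.refl = refl

    eˡ : ∀ m n → e (m ℕ.+ n) ≈ 1# + pw m * pw n
    eˡ m n = +-congˡ (pw-+ m n)

    -- This is (Q;Q)_n. All cancellation goes through such inverses, because the ring of
    -- application, 𝔽₂[[q]] modulo q^(N+1), has zero divisors.
    p⁻¹ : ℕ → Carrier
    p⁻¹ zero    = 1#
    p⁻¹ (suc n) = p⁻¹ n * e (suc n)

    p⁻¹-inverse : ∀ n → p⁻¹ n * p n ≈ 1#
    p⁻¹-inverse zero    = trans (*-identityˡ _) p-0
    p⁻¹-inverse (suc n) = trans (*-assoc _ _ _) (trans (*-congˡ (p-suc n)) (p⁻¹-inverse n))

    p-cancelˡ : ∀ n {x y} → p n * x ≈ p n * y → x ≈ y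
    p-cancelˡ n {x} {y} eq = begin
      x                   ≈⟨ lem x ⟨
      p⁻¹ n * (p n * x)   ≈⟨ *-congˡ eq ⟩
      p⁻¹ n * (p n * y)   ≈⟨ lem y ⟩
      y                   ∎
      where
      lem : ∀ z → p⁻¹ n * (p n * z) ≈ z
      lem z = trans (sym (*-assoc _ _ _)) (trans (*-congʳ (p⁻¹-inverse n)) (*-identityˡ z))

    e-cancelˡ : ∀ n {x y} → e (suc n) * x ≈ e (suc n) * y → x ≈ y
    e-cancelˡ n {x} {y} eq = p-cancelˡ n (begin
      p n * x                       ≈⟨ lem x ⟨
      p (suc n) * (e (suc n) * x)   ≈⟨ *-congˡ eq ⟩
      p (suc n) * (e (suc n) * y)   ≈⟨ lem y ⟩
      p n * y                       ∎)
      where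
      lem : ∀ z → p (suc n) * (e (suc n) * z) ≈ p n * z
      lem z = trans (solve 3 (λ a b c → a :* (b :* c) := (b :* a) :* c) refl _ _ _) (*-congʳ (p-suc n))

    -- The telescoping sum behind the unit Bailey pair relative to a = q.
    unit-pair : ∀ s r → e (r ℕ.+ s) * antidiagonal s
      (λ i j → (T (r ℕ.+ i) * e (suc (2 ℕ.* (r ℕ.+ i)))) * (pw j * (p j * p (suc (2 ℕ.* (r ℕ.+ i) ℕ.+ j)))))
                  ≈ (T r * e r) * (pw s * (p s * p (2 ℕ.* r ℕ.+ s)))
    unit-pair zero r = begin
      e (r ℕ.+ 0) * ((T (r ℕ.+ 0) * e (suc (2 ℕ.* (r ℕ.+ 0)))) * (pw 0 * (p 0 * p (suc (2 ℕ.* (r ℕ.+ 0) ℕ.+ 0)))))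
        ≈⟨ reflexive (≡.cong₂ (λ a b → e a * ((T a * e (suc (2 ℕ.* a))) * (pw 0 * (p 0 * p (suc b)))))
          (ℕ.+-identityʳ r) (≡.trans (ℕ.+-identityʳ _) (≡.cong (2 ℕ.*_) (ℕ.+-identityʳ r)))) ⟩
      e r * ((T r * e (suc (2 ℕ.* r))) * (pw 0 * (p 0 * p (suc (2 ℕ.* r)))))
        ≈⟨ solve 6 (λ a b c d f g → a :* ((b :* c) :* (d :* (f :* g))) := (b :* a) :*
          (d :* (f :* (c :* g)))) refl _ _ _ _ _ _ ⟩
      (T r * e r) * (pw 0 * (p 0 * (e (suc (2 ℕ.* r)) * p (suc (2 ℕ.* r)))))
        ≈⟨ *-congˡ (*-congˡ (*-congˡ (trans (p-suc (2 ℕ.* r)) (p-≡ (≡.sym (ℕ.+-identityʳ _)))))) ⟩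
      (T r * e r) * (pw 0 * (p 0 * p (2 ℕ.* r ℕ.+ 0))) ∎
    unit-pair (suc s) r = begin
      e (r ℕ.+ suc s) * (first + rest)
        ≈⟨ *-congˡ (+-cong first-eq rest-eq) ⟩
      e m * ((T r * (1# + q * (a * a))) * ((q * b) * (P * P′)) + rest′)
        ≈⟨ distribˡ _ _ _ ⟩
      e m * ((T r * (1# + q * (a * a))) * ((q * b) * (P * P′))) + e m * rest′
        -- Without its first term the sum is the one for r + 1 and s. As r + (s + 1) = (r + 1) + s,
        -- the prefactor is also the one that the induction hypothesis asks for.
        ≈⟨ +-cong (*-congʳ em-eq) (trans (*-congʳ (e-≡ (ℕ.+-suc r s))) (unit-pair s (suc r))) ⟩
      (1# + a * (q * b)) * ((T r * (1# + q * (a * a))) * ((q * b) * (P * P′)))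
        + (T (suc r) * e (suc r)) * (pw s * (p s * p (2 ℕ.* suc r ℕ.+ s)))
        ≈⟨ +-congˡ (*-cong (*-cong T-suc er1) (*-congˡ (*-cong ps (p-≡ ix)))) ⟩
      (1# + a * (q * b)) * ((T r * (1# + q * (a * a))) * ((q * b) * (P * P′)))
        + ((q * a * T r) * (1# + q * a)) * (b * (((1# + q * b) * P) * P′))
        ≈⟨ solve 6 (λ a b q P P′ t → let o = con true in
             (o :+ a :* (q :* b)) :* ((t :* (o :+ q :* (a :* a))) :* ((q :* b) :* (P :* P′))) :+
               ((q :* a :* t) :* (o :+ q :* a)) :* (b :* (((o :+ q :* b) :* P) :* P′))
             := (t :* (o :+ a)) :* ((q :* b) :* (P :* ((o :+ (q :* q) :* (a :* a :* b)) :* P′)))) refl a b q P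
               P′ (T r) ⟩
      (T r * (1# + a)) * ((q * b) * (P * ((1# + (q * q) * (a * a * b)) * P′)))
        ≈⟨ *-congˡ (*-cong (sym (pw-+ 1 s)) (*-congˡ last-eq)) ⟩
      (T r * e r) * (pw (suc s) * (p (suc s) * p (2 ℕ.* r ℕ.+ suc s))) ∎
      where
      m = r ℕ.+ suc s
      a = pw r
      b = pw s
      q = pw 1
      P = p (suc s)
      P′ = p (2 ℕ.+ (2 ℕ.* r ℕ.+ s))
      first = (T (r ℕ.+ 0) * e (suc (2 ℕ.* (r ℕ.+ 0)))) *
        (pw (suc s) * (p (suc s) * p (suc (2 ℕ.* (r ℕ.+ 0) ℕ.+ suc s))))
      rest = antidiagonal s (λ i j → (T (r ℕ.+ suc i) * e (suc (2 ℕ.* (r ℕ.+ suc i)))) *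
        (pw j * (p j * p (suc (2 ℕ.* (r ℕ.+ suc i) ℕ.+ j)))))
      rest′ = antidiagonal s (λ i j → (T (suc r ℕ.+ i) * e (suc (2 ℕ.* (suc r ℕ.+ i)))) *
        (pw j * (p j * p (suc (2 ℕ.* (suc r ℕ.+ i) ℕ.+ j)))))
      double : pw (2 ℕ.* r) ≈ a * a
      double = trans (pw-+ r (r ℕ.+ 0)) (*-congˡ (pw-≡ (ℕ.+-identityʳ r)))
      e-odd : e (suc (2 ℕ.* r)) ≈ 1# + q * (a * a)
      e-odd = trans (eˡ 1 (2 ℕ.* r)) (+-congˡ (*-congˡ double))
      first-eq : first ≈ (T r * (1# + q * (a * a))) * ((q * b) * (P * P′))
      first-eq = trans
        (reflexive (≡.cong (λ a → (T a * e (suc (2 ℕ.* a))) *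
          (pw (suc s) * (p (suc s) * p (suc (2 ℕ.* a ℕ.+ suc s))))) (ℕ.+-identityʳ r)))
        (*-cong (*-congˡ e-odd) (*-cong (pw-+ 1 s) (*-congˡ (p-≡ (≡.cong suc (ℕ.+-suc _ s))))))
      rest-eq : rest ≈ rest′
      rest-eq = antidiagonal-cong s λ i j _ → reflexive
        (≡.cong (λ a → (T a * e (suc (2 ℕ.* a))) * (pw j * (p j * p (suc (2 ℕ.* a ℕ.+ j))))) (ℕ.+-suc r i))
      em-eq : e m ≈ 1# + a * (q * b)
      em-eq = trans (eˡ r (suc s)) (+-congˡ (*-congˡ (pw-+ 1 s)))
      T-suc : T (suc r) ≈ q * a * T r
      T-suc = trans (pw-+ (suc r) (triangle r)) (*-congʳ (pw-+ 1 r))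
      er1 : e (suc r) ≈ 1# + q * a
      er1 = eˡ 1 r
      ps : p s ≈ (1# + q * b) * P
      ps = trans (sym (p-suc s)) (*-congʳ (eˡ 1 s))
      ix : 2 ℕ.* suc r ℕ.+ s ≡ 2 ℕ.+ (2 ℕ.* r ℕ.+ s)
      ix = lem r s where
        lem : ∀ r s → 2 ℕ.* suc r ℕ.+ s ≡ 2 ℕ.+ (2 ℕ.* r ℕ.+ s)
        lem = solve-∀
      last-eq : (1# + (q * q) * (a * a * b)) * P′ ≈ p (2 ℕ.* r ℕ.+ suc s)
      last-eq = begin
        (1# + (q * q) * (a * a * b)) * P′
          ≈⟨ *-congʳ (+-congˡ (*-cong (sym (pw-+ 1 1)) (trans (*-congʳ (sym double)) (sym (pw-+ (2 ℕ.* r) s))))) ⟩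
        (1# + pw 2 * pw (2 ℕ.* r ℕ.+ s)) * P′
          ≈⟨ *-congʳ (sym (eˡ 2 _)) ⟩
        e (2 ℕ.+ (2 ℕ.* r ℕ.+ s)) * P′
          ≈⟨ p-suc _ ⟩
        p (suc (2 ℕ.* r ℕ.+ s))
          ≈⟨ p-≡ (≡.sym (ℕ.+-suc _ s)) ⟩
        p (2 ℕ.* r ℕ.+ suc s) ∎

    -- At r = 0 the right side of `unit-pair` contains 1 + Q^0 = 1 + 1 = 0, and the factor 1 +
    -- Q^(n+1) on the left can be cancelled.
    orthogonality : ∀ n → antidiagonal (suc n)
      (λ r s → (T r * e (suc (2 ℕ.* r))) * (pw s * (p s * p (suc (2 ℕ.* r ℕ.+ s))))) ≈ 0#
    orthogonality n = e-cancelˡ n (begin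
      e (suc n) * _   ≈⟨ unit-pair (suc n) 0 ⟩
      (T 0 * (1# + pw 0)) * x   ≈⟨ *-congʳ (*-congˡ (trans (+-congˡ pw-0) 1+1≈0)) ⟩
      (T 0 * 0#) * x  ≈⟨ solve 3 (λ t x e → (t :* con false) :* x := e :* con false) refl (T 0) x (e (suc n)) ⟩
      e (suc n) * 0#  ∎)
      where x = pw (suc n) * (p (suc n) * p (suc n))

    durfee-summand : ℕ → ℕ → ℕ → Carrier
    durfee-summand t k l = pw (k ℕ.* (k ℕ.+ t)) * ((p k * p l) * p (k ℕ.+ t))

    -- For k + l = n + 1 split 1 + Q^(k+l) = (1 + Q^l) + Q^l (1 + Q^k). The first part kills l = 0
    -- and otherwise lowers l; the second kills k = 0 and otherwise lowers k, which raises t by one.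
    durfee-step : ∀ n t → e (suc n) * antidiagonal (suc n) (durfee-summand t)
      ≈ antidiagonal n (durfee-summand t) + pw (suc n ℕ.+ t) * antidiagonal n (durfee-summand (suc t))
    durfee-step n t = begin
      e (suc n) * antidiagonal (suc n) (durfee-summand t)
        ≈⟨ sym (antidiagonal-*ˡ (suc n) (e (suc n)) (durfee-summand t)) ⟩
      antidiagonal (suc n) (λ k l → e (suc n) * durfee-summand t k l)
        ≈⟨ antidiagonal-cong (suc n) step ⟩
      antidiagonal (suc n) (λ k l → f k l + g k l)
        ≈⟨ antidiagonal-+ (suc n) f g ⟩
      antidiagonal (suc n) f + antidiagonal (suc n) g
        ≈⟨ +-cong (antidiagonal-last n f) refl ⟩
      (antidiagonal n (λ k l → f k (suc l)) + f (suc n) 0) + (g 0 (suc n) + antidiagonal n (λ k l → g (suc k) l))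
        ≈⟨ +-cong (+-cong (antidiagonal-cong n λ k l _ → f-suc k l) (f-0 (suc n)))
                  (+-cong (g-0 (suc n)) (trans (antidiagonal-cong n g-suc) (antidiagonal-*ˡ n _ _))) ⟩
      (antidiagonal n (durfee-summand t) + 0#) + (0# + pw (suc n ℕ.+ t) * antidiagonal n (durfee-summand (suc t)))
        ≈⟨ +-cong (+-identityʳ _) (+-identityˡ _) ⟩
      antidiagonal n (durfee-summand t) + pw (suc n ℕ.+ t) * antidiagonal n (durfee-summand (suc t)) ∎
      where
      f g : ℕ → ℕ → Carrier
      f k l = pw (k ℕ.* (k ℕ.+ t)) * ((p k * (e l * p l)) * p (k ℕ.+ t))
      g k l = (pw (k ℕ.* (k ℕ.+ t)) * pw l) * (((e k * p k) * p l) * p (k ℕ.+ t))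
      step : ∀ k l → k ℕ.+ l ≡ suc n → e (suc n) * durfee-summand t k l ≈ f k l + g k l
      step k l eq = trans (*-congʳ (trans (e-≡ (≡.sym eq)) (eˡ k l)))
        (solve 6 (λ a b w p p′ p″ → (con true :+ a :* b) :* (w :* ((p :* p′) :* p″))
          := w :* ((p :* ((con true :+ b) :* p′)) :* p″) :+ (w :* b) :*
            ((((con true :+ a) :* p) :* p′) :* p″)) refl _ _ _ _ _ _)
      f-suc : ∀ k l → f k (suc l) ≈ durfee-summand t k l
      f-suc k l = *-congˡ (*-congʳ (*-congˡ (p-suc l)))
      e0 : e 0 ≈ 0#
      e0 = trans (+-congˡ pw-0) 1+1≈0
      f-0 : ∀ k → f k 0 ≈ 0#
      f-0 k = trans (*-congˡ (*-congʳ (*-congˡ (*-congʳ e0))))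
        (solve 4 (λ w p p′ p″ → w :* ((p :* (con false :* p′)) :* p″) := con false) refl _ _ _ _)
      g-0 : ∀ l → g 0 l ≈ 0#
      g-0 l = trans (*-congˡ (*-congʳ (*-congʳ (*-congʳ e0))))
        (solve 4 (λ w p p′ p″ → w :* (((con false :* p) :* p′) :* p″) := con false) refl _ _ _ _)
      g-suc : ∀ k l → k ℕ.+ l ≡ n → g (suc k) l ≈ pw (suc n ℕ.+ t) * durfee-summand (suc t) k l
      g-suc k l eq = begin
        (pw (suc k ℕ.* (suc k ℕ.+ t)) * pw l) * (((e (suc k) * p (suc k)) * p l) * p (suc k ℕ.+ t))
          ≈⟨ *-cong (trans (sym (pw-+ _ l))
            (trans (pw-≡ (≡.trans (ix k l t) (≡.cong (λ m → suc m ℕ.+ t ℕ.+ k ℕ.* (k ℕ.+ suc t)) eq)))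
            (pw-+ (suc n ℕ.+ t) _)))
                    (*-cong (*-congʳ (p-suc k)) (p-≡ (≡.sym (ℕ.+-suc k t)))) ⟩
        (pw (suc n ℕ.+ t) * pw (k ℕ.* (k ℕ.+ suc t))) * ((p k * p l) * p (k ℕ.+ suc t))
          ≈⟨ *-assoc _ _ _ ⟩
        pw (suc n ℕ.+ t) * durfee-summand (suc t) k l ∎
        where
        ix : ∀ k l t → suc k ℕ.* (suc k ℕ.+ t) ℕ.+ l ≡ suc (k ℕ.+ l) ℕ.+ t ℕ.+ k ℕ.* (k ℕ.+ suc t)
        ix = solve-∀

    -- A limiting case of the q-Chu-Vandermonde sum: partitions into at most n + t parts, sorted by
    -- their Durfee rectangle of size k by k + t. The induction on n needs all t at once.
    durfee : ∀ n t → antidiagonal n (durfee-summand t) ≈ p n * p (n ℕ.+ t)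
    durfee zero t = trans (*-cong pw-0 (*-congʳ (*-cong p-0 p-0)))
      (trans (solve 1 (λ x → con true :* ((con true :* con true) :* x) := con true :* x) refl _) (*-congʳ (sym p-0)))
    durfee (suc n) t = e-cancelˡ n (begin
      e (suc n) * antidiagonal (suc n) (durfee-summand t)
        ≈⟨ durfee-step n t ⟩
      antidiagonal n (durfee-summand t) + pw (suc n ℕ.+ t) * antidiagonal n (durfee-summand (suc t))
        ≈⟨ +-cong (durfee n t) (*-congˡ (trans (durfee n (suc t)) (*-congˡ (p-≡ (ℕ.+-suc n t))))) ⟩
      p n * p (n ℕ.+ t) + pw (suc n ℕ.+ t) * (p n * p (suc n ℕ.+ t))
        ≈⟨ +-congʳ (*-congˡ (sym (p-suc _))) ⟩
      p n * ((1# + pw (suc n ℕ.+ t)) * p (suc n ℕ.+ t)) + pw (suc n ℕ.+ t) * (p n * p (suc n ℕ.+ t))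
        ≈⟨ solve 3 (λ w p p′ → p :* ((con true :+ w) :* p′) :+ w :* (p :* p′) := p :* p′) refl _ _ _ ⟩
      p n * p (suc n ℕ.+ t)
        ≈⟨ *-congʳ (sym (p-suc n)) ⟩
      (e (suc n) * p (suc n)) * p (suc n ℕ.+ t)
        ≈⟨ *-assoc _ _ _ ⟩
      e (suc n) * (p (suc n) * p (suc n ℕ.+ t)) ∎)

    -- The partial fraction expansion of 1/(d₀ ⋯ dₙ), d_j = (1 - x Q^j)(1 - Q^{j+1}/x), in the
    -- variable y = x + Q/x; h j stands for 1/d_j.
    module PartialFractions (y : Carrier) (h : ℕ → Carrier)
      (h-inverse : ∀ j → ((1# + pw (suc (2 ℕ.* j))) + pw j * y) * h j ≈ 1#) where

      d : ℕ → Carrier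
      d j = (1# + pw (suc (2 ℕ.* j))) + pw j * y

      H : ℕ → Carrier
      H zero    = h 0
      H (suc n) = H n * h (suc n)

      summand : ℕ → ℕ → Carrier
      summand r s = (T r * e (suc (2 ℕ.* r))) * ((p s * p (suc (2 ℕ.* r ℕ.+ s))) * h r)

      pw-double : ∀ r → pw (2 ℕ.* r) ≈ pw r * pw r
      pw-double r = trans (pw-+ r (r ℕ.+ 0)) (*-congˡ (pw-≡ (ℕ.+-identityʳ r)))

      pw-odd : ∀ r → pw (suc (2 ℕ.* r)) ≈ pw 1 * (pw r * pw r)
      pw-odd r = trans (pw-+ 1 (2 ℕ.* r)) (*-congˡ (pw-double r))

      -- Division of d_(r+s) by d_r as polynomials in y: d_(r+s) = Q^s d_r + (1 + Q^s)(1 +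
      -- Q^(2r+s+1)).
      d*h : ∀ r s → d (r ℕ.+ s) * h r ≈ pw s + (e s * e (suc (2 ℕ.* r ℕ.+ s))) * h r
      d*h r s = begin
        d (r ℕ.+ s) * h r
          ≈⟨ *-congʳ (+-cong (+-congˡ (trans (pw-odd _) (*-congˡ (*-cong (pw-+ r s) (pw-+ r s)))))
            (*-congʳ (pw-+ r s))) ⟩
        ((1# + q * ((a * b) * (a * b))) + (a * b) * y) * h r
          ≈⟨ solve 5 (λ a b q y h → ((con true :+ q :* ((a :* b) :* (a :* b))) :+ (a :* b) :* y) :* h
               := b :* (((con true :+ q :* (a :* a)) :+ a :* y) :* h) :+
                 ((con true :+ b) :* (con true :+ q :* ((a :* a) :* b))) :* h) refl a b q y (h r) ⟩
        b * (((1# + q * (a * a)) + a * y) * h r) + ((1# + b) * (1# + q * ((a * a) * b))) * h r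
          ≈⟨ +-cong (trans (*-congˡ (trans (*-congʳ (+-congʳ (+-congˡ (sym (pw-odd r))))) (h-inverse r)))
            (*-identityʳ b))
                    (*-congʳ (*-congˡ (+-congˡ (trans
                      (*-congˡ (trans (*-congʳ (sym (pw-double r))) (sym (pw-+ (2 ℕ.* r) s)))) (sym (pw-+ 1 _)))))) ⟩
        pw s + (e s * e (suc (2 ℕ.* r ℕ.+ s))) * h r ∎
        where
        a = pw r
        b = pw s
        q = pw 1

      -- By `d*h` every term splits in two. The parts free of `h` add up to zero by `orthogonality`;
      -- in the others the two new factors lower the indices of both `p`'s, which turns s into s - 1
      -- and kills s = 0.
      expansion-step : ∀ n → d (suc n) * antidiagonal (suc n) summand ≈ antidiagonal n summand
      expansion-step n = begin
        d (suc n) * antidiagonal (suc n) summand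
          ≈⟨ sym (antidiagonal-*ˡ (suc n) (d (suc n)) summand) ⟩
        antidiagonal (suc n) (λ r s → d (suc n) * summand r s)
          ≈⟨ antidiagonal-cong (suc n) step ⟩
        antidiagonal (suc n) (λ r s → f r s + g r s)
          ≈⟨ antidiagonal-+ (suc n) f g ⟩
        antidiagonal (suc n) f + antidiagonal (suc n) g
          ≈⟨ +-cong (orthogonality n) (antidiagonal-last n g) ⟩
        0# + (antidiagonal n (λ r s → g r (suc s)) + g (suc n) 0)
          ≈⟨ +-identityˡ _ ⟩
        antidiagonal n (λ r s → g r (suc s)) + g (suc n) 0
          ≈⟨ +-cong (antidiagonal-cong n λ r s _ → g-suc r s) (g-0 (suc n)) ⟩
        antidiagonal n summand + 0#
          ≈⟨ +-identityʳ _ ⟩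
        antidiagonal n summand ∎
        where
        f g : ℕ → ℕ → Carrier
        f r s = (T r * e (suc (2 ℕ.* r))) * (pw s * (p s * p (suc (2 ℕ.* r ℕ.+ s))))
        g r s = (T r * e (suc (2 ℕ.* r))) *
          (((e s * p s) * (e (suc (2 ℕ.* r ℕ.+ s)) * p (suc (2 ℕ.* r ℕ.+ s)))) * h r)
        step : ∀ r s → r ℕ.+ s ≡ suc n → d (suc n) * summand r s ≈ f r s + g r s
        step r s eq = begin
          d (suc n) * summand r s
            ≈⟨ solve 5 (λ d t p p′ h → d :* (t :* ((p :* p′) :* h)) := t :* ((p :* p′) :* (d :* h))) refl _ _ _ _ _ ⟩
          (T r * e (suc (2 ℕ.* r))) * ((p s * p (suc (2 ℕ.* r ℕ.+ s))) * (d (suc n) * h r))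
            ≈⟨ *-congˡ (*-congˡ (trans (*-congʳ (reflexive (≡.cong d (≡.sym eq)))) (d*h r s))) ⟩
          (T r * e (suc (2 ℕ.* r))) * ((p s * p (suc (2 ℕ.* r ℕ.+ s))) *
            (pw s + (e s * e (suc (2 ℕ.* r ℕ.+ s))) * h r))
            ≈⟨ solve 7 (λ t p p′ w e e′ h → t :* ((p :* p′) :* (w :+ (e :* e′) :* h))
                 := t :* (w :* (p :* p′)) :+ t :* (((e :* p) :* (e′ :* p′)) :* h)) refl _ _ _ _ _ _ _ ⟩
          f r s + g r s ∎
        g-suc : ∀ r s → g r (suc s) ≈ summand r s
        g-suc r s = *-congˡ (*-congʳ (*-cong (p-suc s) (trans (p-suc _) (p-≡ (ℕ.+-suc _ s)))))
        g-0 : ∀ r → g r 0 ≈ 0#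
        g-0 r = trans (*-congˡ (*-congʳ (*-congʳ (*-congʳ (trans (+-congˡ pw-0) 1+1≈0)))))
          (solve 4 (λ t p x h → t :* (((con false :* p) :* x) :* h) := con false) refl _ _ _ _)

      expansion : ∀ n → antidiagonal n summand ≈ H n
      expansion zero = begin
        (T 0 * e 1) * ((p 0 * p 1) * h 0)
          ≈⟨ solve 5 (λ t e p p′ h → (t :* e) :* ((p :* p′) :* h) := (t :* p) :* ((e :* p′) :* h)) refl _ _ _ _ _ ⟩
        (T 0 * p 0) * ((e 1 * p 1) * h 0)
          ≈⟨ *-cong (*-cong pw-0 p-0) (*-congʳ (trans (p-suc 0) p-0)) ⟩
        (1# * 1#) * (1# * h 0)
          ≈⟨ solve 1 (λ h → (con true :* con true) :* (con true :* h) := h) refl _ ⟩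
        h 0 ∎
      expansion (suc n) = begin
        x                               ≈⟨ sym (*-identityʳ x) ⟩
        x * 1#                          ≈⟨ *-congˡ (sym (h-inverse (suc n))) ⟩
        x * (d (suc n) * h (suc n))     ≈⟨ solve 3 (λ x d h → x :* (d :* h) := (d :* x) :* h) refl _ _ _ ⟩
        (d (suc n) * x) * h (suc n)     ≈⟨ *-congʳ (trans (expansion-step n) (expansion n)) ⟩
        H n * h (suc n)                 ∎
        where x = antidiagonal (suc n) summand

      -- After expanding `H m` in partial fractions with m = r + s, the exponent splits as m(m+1) =
      -- r(r+1) + s(s+2r+1). For fixed r the sum over s is therefore a Durfee sum with t = 2r + 1.
      finite-appell : ∀ n →
        antidiagonal n (λ m l → pw (m ℕ.* suc m) * (p l * H m)) ≈
        antidiagonal n (λ r j → ((T r * e (suc (2 ℕ.* r))) * (pw (r ℕ.* suc r) * h r)) *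
          (p j * p (j ℕ.+ suc (2 ℕ.* r))))
      finite-appell n = begin
        antidiagonal n (λ m l → pw (m ℕ.* suc m) * (p l * H m))
          ≈⟨ antidiagonal-cong n (λ m l _ → expand m l) ⟩
        antidiagonal n (λ m l → antidiagonal m (λ r s → c r * durfee-summand (suc (2 ℕ.* r)) s l))
          ≈⟨ antidiagonal-assoc n (λ r s l → c r * durfee-summand (suc (2 ℕ.* r)) s l) ⟩
        antidiagonal n (λ r j → antidiagonal j (λ s l → c r * durfee-summand (suc (2 ℕ.* r)) s l))
          ≈⟨ antidiagonal-cong n (λ r j _ → trans (antidiagonal-*ˡ j (c r) (durfee-summand (suc (2 ℕ.* r))))
            (*-congˡ (durfee j _))) ⟩
        antidiagonal n (λ r j → c r * (p j * p (j ℕ.+ suc (2 ℕ.* r)))) ∎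
        where
        c : ℕ → Carrier
        c r = (T r * e (suc (2 ℕ.* r))) * (pw (r ℕ.* suc r) * h r)
        expand : ∀ m l → pw (m ℕ.* suc m) * (p l * H m)
          ≈ antidiagonal m (λ r s → c r * durfee-summand (suc (2 ℕ.* r)) s l)
        expand m l = begin
          pw (m ℕ.* suc m) * (p l * H m)
            ≈⟨ trans (sym (*-assoc _ _ _)) (*-congˡ (sym (expansion m))) ⟩
          (pw (m ℕ.* suc m) * p l) * antidiagonal m summand
            ≈⟨ sym (antidiagonal-*ˡ m (pw (m ℕ.* suc m) * p l) summand) ⟩
          antidiagonal m (λ r s → (pw (m ℕ.* suc m) * p l) * summand r s)
            ≈⟨ antidiagonal-cong m term ⟩
          antidiagonal m (λ r s → c r * durfee-summand (suc (2 ℕ.* r)) s l) ∎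
          where
          ix : ∀ r s → (r ℕ.+ s) ℕ.* suc (r ℕ.+ s) ≡ r ℕ.* suc r ℕ.+ s ℕ.* (s ℕ.+ suc (2 ℕ.* r))
          ix = solve-∀
          ix′ : ∀ r s → suc (2 ℕ.* r ℕ.+ s) ≡ s ℕ.+ suc (2 ℕ.* r)
          ix′ = solve-∀
          term : ∀ r s → r ℕ.+ s ≡ m → (pw (m ℕ.* suc m) * p l) * summand r s
            ≈ c r * durfee-summand (suc (2 ℕ.* r)) s l
          term r s ≡.refl = trans
            (*-cong (*-congʳ (trans (pw-≡ (ix r s)) (pw-+ (r ℕ.* suc r) _)))
              (*-congˡ (*-congʳ (*-congˡ (p-≡ (ix′ r s))))))
            (solve 7 (λ a b p t p′ p″ h → ((a :* b) :* p) :* (t :* ((p′ :* p″) :* h))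
              := (t :* (a :* h)) :* (b :* ((p′ :* p) :* p″))) refl _ _ _ _ _ _ _)

    -- Limits of the finite identities, in the form Q^(M+1) = 0

    module Truncated (M : ℕ) (pw-top : pw (suc M) ≈ 0#) where

      pw-vanish : ∀ {k} → M ℕ.< k → pw k ≈ 0#
      pw-vanish {k} M<k = trans (pw-≡ (≡.sym (ℕ.m+[n∸m]≡n M<k)))
        (trans (pw-+ (suc M) _) (trans (*-congʳ pw-top) (zeroˡ _)))

      -- The two values of `p` differ by factors 1 + Q^j with j > l, and these act on z as 1. In
      -- this way `p M` replaces the infinite product.
      p-stable : ∀ k l z → pw (suc l) * z ≈ 0# → p (k ℕ.+ l) * z ≈ p l * z
      p-stable zero    l z eq = refl
      p-stable (suc k) l z eq = begin
        x * z
          ≈⟨ sym (+-identityʳ _) ⟩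
        x * z + 0#
          ≈⟨ +-congˡ (sym (trans (*-congˡ eq) (zeroʳ _))) ⟩
        x * z + (x * pw k) * (pw (suc l) * z)
          ≈⟨ solve 4 (λ x z a b → x :* z :+ (x :* a) :* (b :* z) := ((con true :+ a :* b) :* x) :* z) refl x z _ _ ⟩
        ((1# + pw k * pw (suc l)) * x) * z
          ≈⟨ *-congʳ (*-congʳ (trans (sym (eˡ k (suc l))) (e-≡ (ℕ.+-suc k l)))) ⟩
        (e (suc (k ℕ.+ l)) * x) * z
          ≈⟨ *-congʳ (p-suc _) ⟩
        p (k ℕ.+ l) * z
          ≈⟨ p-stable k l z eq ⟩
        p l * z ∎
        where x = p (suc k ℕ.+ l)

      p-pair-stable : ∀ k r s z → r ℕ.+ s ≡ M → pw (suc s) * z ≈ 0# → z * (p s * p (k ℕ.+ s)) ≈ (p M * p M) * z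
      p-pair-stable k r s z ≡.refl eq = begin
        z * (p s * p (k ℕ.+ s))          ≈⟨ solve 3 (λ z p p′ → z :* (p :* p′) := p :* (p′ :* z)) refl _ _ _ ⟩
        p s * (p (k ℕ.+ s) * z)          ≈⟨ *-congˡ (trans (p-stable k s z eq) (sym (p-stable r s z eq))) ⟩
        p s * (p (r ℕ.+ s) * z)          ≈⟨ solve 3 (λ z p p′ → p :* (p′ :* z) := p′ :* (p :* z)) refl _ _ _ ⟩
        p (r ℕ.+ s) * (p s * z)          ≈⟨ *-congˡ (sym (p-stable r s z eq)) ⟩
        p (r ℕ.+ s) * (p (r ℕ.+ s) * z)  ≈⟨ sym (*-assoc _ _ _) ⟩
        (p (r ℕ.+ s) * p (r ℕ.+ s)) * z  ∎

      pw-absorb : ∀ k s z → M ℕ.< s ℕ.+ k → pw s * (pw k * z) ≈ 0#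
      pw-absorb k s z M<s+k = trans (sym (*-assoc _ _ _))
        (trans (*-congʳ (trans (sym (pw-+ s k)) (pw-vanish M<s+k))) (zeroˡ z))

      module _ (y : Carrier) (h : ℕ → Carrier)
        (h-inverse : ∀ j → ((1# + pw (suc (2 ℕ.* j))) + pw j * y) * h j ≈ 1#) where

        open PartialFractions y h h-inverse

        -- The limit of `finite-appell` at n = M. As m(m+1) ≥ m, the term with m + l = M is
        -- annihilated by Q^(l+1), so all its factors `p` may be replaced by `p M`: one on the left,
        -- two on the right, and one cancels.
        appell : range-sum M (λ m → pw (m ℕ.* suc m) * H m) ≈
                 p M * range-sum M (λ r → (T r * pw (r ℕ.* suc r)) * (e (suc (2 ℕ.* r)) * h r))
        appell = p-cancelˡ M (begin
          p M * range-sum M (λ m → pw (m ℕ.* suc m) * H m)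
            ≈⟨ sym (trans (antidiagonal-*ˡ M (p M) (λ m _ → pw (m ℕ.* suc m) * H m))
              (*-congˡ (antidiagonal-fst M (λ m → pw (m ℕ.* suc m) * H m)))) ⟩
          antidiagonal M (λ m _ → p M * (pw (m ℕ.* suc m) * H m))
            ≈⟨ antidiagonal-cong M left ⟩
          antidiagonal M (λ m l → pw (m ℕ.* suc m) * (p l * H m))
            ≈⟨ finite-appell M ⟩
          antidiagonal M (λ r j → ((T r * e (suc (2 ℕ.* r))) * (pw (r ℕ.* suc r) * h r)) *
            (p j * p (j ℕ.+ suc (2 ℕ.* r))))
            ≈⟨ antidiagonal-cong M right ⟩
          antidiagonal M (λ r _ → (p M * p M) * z r)
            ≈⟨ trans (antidiagonal-*ˡ M (p M * p M) (λ r _ → z r)) (*-congˡ (antidiagonal-fst M z)) ⟩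
          (p M * p M) * range-sum M z
            ≈⟨ *-assoc _ _ _ ⟩
          p M * (p M * range-sum M z) ∎)
          where
          z : ℕ → Carrier
          z r = (T r * pw (r ℕ.* suc r)) * (e (suc (2 ℕ.* r)) * h r)
          bound : ∀ r s → r ℕ.+ s ℕ.< suc s ℕ.+ r ℕ.* suc r
          bound r s = ≡.subst (ℕ._< suc s ℕ.+ r ℕ.* suc r) (ℕ.+-comm s r) (ℕ.+-monoʳ-≤ (suc s) (ℕ.m≤m*n r (suc r)))
          left : ∀ m l → m ℕ.+ l ≡ M → p M * (pw (m ℕ.* suc m) * H m) ≈ pw (m ℕ.* suc m) * (p l * H m)
          left m l ≡.refl = trans
            (p-stable m l (pw (m ℕ.* suc m) * H m) (pw-absorb (m ℕ.* suc m) (suc l) (H m) (bound m l)))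
            (solve 3 (λ p w h → p :* (w :* h) := w :* (p :* h)) refl _ _ _)
          right : ∀ r j → r ℕ.+ j ≡ M → ((T r * e (suc (2 ℕ.* r))) * (pw (r ℕ.* suc r) * h r)) *
            (p j * p (j ℕ.+ suc (2 ℕ.* r))) ≈ (p M * p M) * z r
          right r j eq = begin
            ((T r * e (suc (2 ℕ.* r))) * (pw (r ℕ.* suc r) * h r)) * (p j * p (j ℕ.+ suc (2 ℕ.* r)))
              ≈⟨ *-cong (solve 4 (λ t e w h → (t :* e) :* (w :* h) := (t :* w) :* (e :* h)) refl _ _ _ _)
                (*-congˡ (p-≡ (ℕ.+-comm j _))) ⟩
            z r * (p j * p (suc (2 ℕ.* r) ℕ.+ j))
              ≈⟨ p-pair-stable _ r j (z r) eq (trans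
                   (*-congˡ (solve 4 (λ t w e h → (t :* w) :* (e :* h) := w :* ((t :* e) :* h)) refl _ _ _ _))
                   (pw-absorb (r ℕ.* suc r) (suc j) _ (≡.subst (ℕ._< suc j ℕ.+ r ℕ.* suc r) eq (bound r j)))) ⟩
            (p M * p M) * z r ∎

      -- This is 1/(1 + Q^(2j+1)), written as a quotient of consecutive values of `p`.
      g : ℕ → Carrier
      g j = p (suc (2 ℕ.* j)) * p⁻¹ (2 ℕ.* j)

      e*g : ∀ j → e (suc (2 ℕ.* j)) * g j ≈ 1#
      e*g j = trans (sym (*-assoc _ _ _)) (trans (*-congʳ (p-suc _)) (trans (*-comm _ _) (p⁻¹-inverse _)))

      g-inverse : ∀ j → ((1# + pw (suc (2 ℕ.* j))) + pw j * 0#) * g j ≈ 1#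
      g-inverse j = trans (*-congʳ (trans (+-congˡ (zeroʳ _)) (+-identityʳ _))) (e*g j)

      open PartialFractions 0# g g-inverse

      -- At y = 0 the numerator 1 + Q^(2r+1) of the r-th partial fraction cancels its denominator,
      -- and the expansion degenerates to a theta series.
      H-limit : H M ≈ (p M * p M) * range-sum M T
      H-limit = begin
        H M
          ≈⟨ sym (expansion M) ⟩
        antidiagonal M summand
          ≈⟨ antidiagonal-cong M term ⟩
        antidiagonal M (λ r _ → (p M * p M) * T r)
          ≈⟨ trans (antidiagonal-*ˡ M (p M * p M) (λ r _ → T r)) (*-congˡ (antidiagonal-fst M T)) ⟩
        (p M * p M) * range-sum M T ∎
        where
        term : ∀ r s → r ℕ.+ s ≡ M → summand r s ≈ (p M * p M) * T r
        term r s eq = begin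
          (T r * e (suc (2 ℕ.* r))) * ((p s * p (suc (2 ℕ.* r ℕ.+ s))) * g r)
            ≈⟨ solve 5 (λ t e p p′ g → (t :* e) :* ((p :* p′) :* g) := (t :* (p :* p′)) :* (e :* g)) refl _ _ _ _ _ ⟩
          (T r * (p s * p (suc (2 ℕ.* r ℕ.+ s)))) * (e (suc (2 ℕ.* r)) * g r)
            ≈⟨ trans (*-congˡ (e*g r)) (*-identityʳ _) ⟩
          T r * (p s * p (suc (2 ℕ.* r) ℕ.+ s))
            ≈⟨ p-pair-stable _ r s (T r) eq (trans (*-congˡ (sym (*-identityʳ _))) (pw-absorb (triangle r) (suc s) 1#
                 (≡.subst (ℕ._< suc s ℕ.+ triangle r) (≡.trans (ℕ.+-comm s r) eq)
                   (ℕ.+-monoʳ-≤ (suc s) (triangle-≥ r))))) ⟩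
          (p M * p M) * T r ∎

      -- In characteristic 2, 1 + Q^(2k) = (1 + Q^k)². Hence the factors with even exponent
      -- contribute the square of `p n`, and those with odd exponent are `H n`.
      p-odd : ∀ n → p (suc (2 ℕ.* n)) ≈ (p n * p n) * H n
      p-odd zero = trans (sym (*-identityʳ _))
        (trans (solve 1 (λ x → x := (con true :* con true) :* x) refl _) (*-congʳ (*-cong (sym p-0) (sym p-0))))
      p-odd (suc n) = begin
        p (suc (2 ℕ.* suc n))
          ≈⟨ trans (sym (*-identityʳ _)) (*-congˡ (sym (p⁻¹-inverse (2 ℕ.* suc n)))) ⟩
        p (suc (2 ℕ.* suc n)) * (p⁻¹ (2 ℕ.* suc n) * p (2 ℕ.* suc n))
          ≈⟨ trans (sym (*-assoc _ _ _)) (*-congˡ even) ⟩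
        g (suc n) * ((P * P) * H n)
          ≈⟨ solve 3 (λ g p h → g :* (p :* h) := p :* (h :* g)) refl _ _ _ ⟩
        (P * P) * (H n * g (suc n)) ∎
        where
        P = p (suc n)
        double : 2 ℕ.* suc n ≡ suc (suc (2 ℕ.* n))
        double = ℕ.*-suc 2 n
        square : e (2 ℕ.* suc n) ≈ e (suc n) * e (suc n)
        square = trans (+-congˡ (pw-double (suc n)))
          (solve 1 (λ a → con true :+ a :* a := (con true :+ a) :* (con true :+ a)) refl (pw (suc n)))
        even : p (2 ℕ.* suc n) ≈ (P * P) * H n
        even = e-cancelˡ n (e-cancelˡ n (begin
          e (suc n) * (e (suc n) * p (2 ℕ.* suc n))
            ≈⟨ trans (sym (*-assoc _ _ _)) (*-congʳ (sym square)) ⟩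
          e (2 ℕ.* suc n) * p (2 ℕ.* suc n)
            ≈⟨ *-cong (e-≡ double) (p-≡ double) ⟩
          e (suc (suc (2 ℕ.* n))) * p (suc (suc (2 ℕ.* n)))
            ≈⟨ trans (p-suc _) (p-odd n) ⟩
          (p n * p n) * H n
            ≈⟨ *-congʳ (*-cong (sym (p-suc n)) (sym (p-suc n))) ⟩
          ((e (suc n) * P) * (e (suc n) * P)) * H n
            ≈⟨ solve 3 (λ e p h → ((e :* p) :* (e :* p)) :* h := e :* (e :* ((p :* p) :* h))) refl _ _ _ ⟩
          e (suc n) * (e (suc n) * ((P * P) * H n)) ∎))

      -- Gauss's ψ (Q;Q)_∞ = (Q;Q)_∞⁴ (mod 2), from the partial fractions at y = 0, where d_j = 1 + Q^(2j+1).
      gauss : p M ≈ ((p M * p M) * (p M * p M)) * range-sum M T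
      gauss = begin
        p M
          ≈⟨ sym (*-identityʳ _) ⟩
        p M * 1#
          ≈⟨ sym (p-stable (suc M) M 1# (trans (*-congʳ pw-top) (zeroˡ _))) ⟩
        p (suc M ℕ.+ M) * 1#
          ≈⟨ trans (*-identityʳ _) (p-≡ (≡.cong (λ k → suc (M ℕ.+ k)) (≡.sym (ℕ.+-identityʳ M)))) ⟩
        p (suc (2 ℕ.* M))
          ≈⟨ trans (p-odd M) (*-congˡ H-limit) ⟩
        (p M * p M) * ((p M * p M) * range-sum M T)
          ≈⟨ sym (*-assoc _ _ _) ⟩
        ((p M * p M) * (p M * p M)) * range-sum M T ∎

-- Power series over 𝔽₂

⨁ : ℕ → (ℕ → Bool) → Bool
⨁ zero    f = false
⨁ (suc n) f = ⨁ n f xor f n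

⨁-cong : ∀ n {f g} → (∀ i → i ℕ.< n → f i ≡ g i) → ⨁ n f ≡ ⨁ n g
⨁-cong zero    h = ≡.refl
⨁-cong (suc n) h = cong₂ _xor_ (⨁-cong n λ i i<n → h i (ℕ.m<n⇒m<1+n i<n)) (h n ℕ.≤-refl)

xor-interchange : ∀ a b c d → (a xor b) xor (c xor d) ≡ (a xor c) xor (b xor d)
xor-interchange = interchange
  where open import Algebra.Properties.CommutativeSemigroup (CommutativeRing.+-commutativeSemigroup xor-∧-commutativeRing) using (interchange)

xor-swap : ∀ a b c → a xor (b xor c) ≡ b xor (a xor c)
xor-swap = x∙yz≈y∙xz
  where open import Algebra.Properties.CommutativeSemigroup (CommutativeRing.+-commutativeSemigroup xor-∧-commutativeRing) using (x∙yz≈y∙xz)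

Series : Set
Series = ℕ → Bool

infixl 7 _⊗_
infixl 6 _⊞_

_⊞_ : Series → Series → Series
(f ⊞ g) n = f n xor g n

_⊗_ : Series → Series → Series
(f ⊗ g) zero    = f 0 ∧ g 0
(f ⊗ g) (suc n) = (f 0 ∧ g (suc n)) xor ((f ∘ suc) ⊗ g) n

𝟘 𝟙 : Series
𝟘 _ = false
𝟙 zero    = true
𝟙 (suc _) = false

⊗-cong : ∀ n {f f′ g g′} → (∀ i → i ℕ.≤ n → f i ≡ f′ i) → (∀ i → i ℕ.≤ n → g i ≡ g′ i) → (f ⊗ g) n ≡ (f′ ⊗ g′) n
⊗-cong zero    p q = cong₂ _∧_ (p 0 z≤n) (q 0 z≤n)
⊗-cong (suc n) p q = cong₂ _xor_ (cong₂ _∧_ (p 0 z≤n) (q (suc n) ℕ.≤-refl))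
  (⊗-cong n (λ i i≤n → p (suc i) (s≤s i≤n)) (λ i i≤n → q i (ℕ.m≤n⇒m≤1+n i≤n)))

⊗-distribʳ : ∀ n f g h → ((f ⊞ g) ⊗ h) n ≡ (f ⊗ h) n xor (g ⊗ h) n
⊗-distribʳ zero    f g h = ∧-distribʳ-xor (h 0) (f 0) (g 0)
⊗-distribʳ (suc n) f g h = ≡.trans
  (cong₂ _xor_ (∧-distribʳ-xor (h (suc n)) (f 0) (g 0)) (⊗-distribʳ n (f ∘ suc) (g ∘ suc) h))
  (xor-interchange (f 0 ∧ h (suc n)) _ _ _)

⊗-scaleˡ : ∀ n b f g → ((λ i → b ∧ f i) ⊗ g) n ≡ b ∧ (f ⊗ g) n
⊗-scaleˡ zero    b f g = ∧-assoc b (f 0) (g 0)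
⊗-scaleˡ (suc n) b f g = ≡.trans
  (cong₂ _xor_ (∧-assoc b (f 0) (g (suc n))) (⊗-scaleˡ n b (f ∘ suc) g))
  (≡.sym (∧-distribˡ-xor b _ _))

⊗-zeroˡ : ∀ n f → (𝟘 ⊗ f) n ≡ false
⊗-zeroˡ zero    f = ≡.refl
⊗-zeroˡ (suc n) f = ⊗-zeroˡ n f

⊗-identityˡ : ∀ n f → (𝟙 ⊗ f) n ≡ f n
⊗-identityˡ zero    f = ≡.refl
⊗-identityˡ (suc n) f = ≡.trans (cong (f (suc n) xor_) (⊗-zeroˡ n f)) (xor-identityʳ _)

⊗-assoc : ∀ n f g h → ((f ⊗ g) ⊗ h) n ≡ (f ⊗ (g ⊗ h)) n
⊗-assoc zero    f g h = ∧-assoc (f 0) (g 0) (h 0)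
⊗-assoc (suc n) f g h = begin
  ((f 0 ∧ g 0) ∧ h (suc n)) xor (((λ i → f 0 ∧ g (suc i)) ⊞ ((f ∘ suc) ⊗ g)) ⊗ h) n
    ≡⟨ cong₂ _xor_ (∧-assoc (f 0) (g 0) (h (suc n)))
         (≡.trans (⊗-distribʳ n (λ i → f 0 ∧ g (suc i)) ((f ∘ suc) ⊗ g) h)
                  (cong₂ _xor_ (⊗-scaleˡ n (f 0) (g ∘ suc) h) (⊗-assoc n (f ∘ suc) g h))) ⟩
  (f 0 ∧ (g 0 ∧ h (suc n))) xor ((f 0 ∧ ((g ∘ suc) ⊗ h) n) xor ((f ∘ suc) ⊗ (g ⊗ h)) n)
    ≡⟨ ≡.sym (xor-assoc (f 0 ∧ (g 0 ∧ h (suc n))) _ _) ⟩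
  ((f 0 ∧ (g 0 ∧ h (suc n))) xor (f 0 ∧ ((g ∘ suc) ⊗ h) n)) xor ((f ∘ suc) ⊗ (g ⊗ h)) n
    ≡⟨ cong (_xor ((f ∘ suc) ⊗ (g ⊗ h)) n) (≡.sym (∧-distribˡ-xor (f 0) _ _)) ⟩
  (f 0 ∧ (g ⊗ h) (suc n)) xor ((f ∘ suc) ⊗ (g ⊗ h)) n ∎
  where open ≡.≡-Reasoning

⊗-comm : ∀ n f g → (f ⊗ g) n ≡ (g ⊗ f) n
⊗-suc : ∀ n f g → (f ⊗ g) (suc n) ≡ (g 0 ∧ f (suc n)) xor (f ⊗ (g ∘ suc)) n

⊗-comm zero    f g = ∧-comm (f 0) (g 0)
⊗-comm (suc n) f g = ≡.trans (⊗-suc n f g) (cong ((g 0 ∧ f (suc n)) xor_) (⊗-comm n f (g ∘ suc)))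

⊗-suc zero    f g = ≡.trans (xor-comm (f 0 ∧ g 1) _) (cong (_xor (f 0 ∧ g 1)) (∧-comm (f 1) (g 0)))
⊗-suc (suc n) f g = ≡.trans (cong ((f 0 ∧ g (2 ℕ.+ n)) xor_) (⊗-suc n (f ∘ suc) g))
  (xor-swap (f 0 ∧ g (2 ℕ.+ n)) (g 0 ∧ f (2 ℕ.+ n)) _)

-- 𝔽₂[[q]] modulo q^(N+1).
seriesUpTo : ℕ → CommutativeSemiring 0ℓ 0ℓ
seriesUpTo N = record
  { Carrier = Series
  ; _≈_ = λ f g → ∀ i → i ℕ.≤ N → f i ≡ g i
  ; _+_ = _⊞_
  ; _*_ = _⊗_
  ; 0# = 𝟘
  ; 1# = 𝟙
  ; isCommutativeSemiring = isCommutativeSemiringˡ record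
    { +-isCommutativeMonoid = record
      { isMonoid = record
        { isSemigroup = record
          { isMagma = record
            { isEquivalence = isEq
            ; ∙-cong = λ p q i i≤N → cong₂ _xor_ (p i i≤N) (q i i≤N) }
          ; assoc = λ f g h i _ → xor-assoc (f i) (g i) (h i) }
        ; identity = (λ f i _ → ≡.refl) , (λ f i _ → xor-identityʳ (f i)) }
      ; comm = λ f g i _ → xor-comm (f i) (g i) }
    ; *-isCommutativeMonoid = record
      { isMonoid = record
        { isSemigroup = record
          { isMagma = record
            { isEquivalence = isEq
            ; ∙-cong = λ p q i i≤N → ⊗-cong i (λ j j≤i → p j (ℕ.≤-trans j≤i i≤N))
              (λ j j≤i → q j (ℕ.≤-trans j≤i i≤N)) }
          ; assoc = λ f g h i _ → ⊗-assoc i f g h }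
        ; identity = (λ f i _ → ⊗-identityˡ i f) , (λ f i _ → ≡.trans (⊗-comm i f 𝟙) (⊗-identityˡ i f)) }
      ; comm = λ f g i _ → ⊗-comm i f g }
    ; distribʳ = λ h f g i _ → ⊗-distribʳ i f g h
    ; zeroˡ = λ f i _ → ⊗-zeroˡ i f
    }
  }
  where
  isEq : IsEquivalence (λ (f g : Series) → ∀ i → i ℕ.≤ N → f i ≡ g i)
  isEq = record { refl = λ _ _ → ≡.refl ; sym = λ p i i≤N → ≡.sym (p i i≤N) ; trans = λ p q i i≤N → ≡.trans
    (p i i≤N) (q i i≤N) }

⊗-support : ∀ n f g → (f ⊗ g) n ≡ true → ∃ λ i → ∃ λ j → i ℕ.+ j ≡ n × f i ≡ true × g j ≡ true
⊗-support zero f g eq with f 0 in f0 | g 0 in g0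
... | true | true = 0 , 0 , ≡.refl , f0 , g0
⊗-support (suc n) f g eq with f 0 in f0 | g (suc n) in gn
... | true  | true  = 0 , suc n , ≡.refl , f0 , gn
... | true  | false = let (i , j , i+j≡n , fi , gj) = ⊗-support n (f ∘ suc) g eq in suc i , j , cong suc i+j≡n ,
  fi , gj
... | false | _     = let (i , j , i+j≡n , fi , gj) = ⊗-support n (f ∘ suc) g eq in suc i , j , cong suc i+j≡n ,
  fi , gj

-- Supports and squares

SupportedOn : ℕ → Series → Set
SupportedOn d f = ∀ n → f n ≡ true → d ∣ n

⊗-supportedOn : ∀ {d f g} → SupportedOn d f → SupportedOn d g → SupportedOn d (f ⊗ g)
⊗-supportedOn {d} {f} {g} p q n eq with ⊗-support n f g eq
... | i , j , ≡.refl , fi , gj = ∣m∣n⇒∣m+n (p i fi) (q j gj)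

-- Squaring is the substitution q ↦ q²: the products f i ∧ f j and f j ∧ f i cancel, and only i = j
-- survives. `square-step` removes the outermost such pair.
square-odd : ∀ n f → (f ⊗ f) (suc (n ℕ.+ n)) ≡ false
square-even : ∀ n f → (f ⊗ f) (n ℕ.+ n) ≡ f n
square-step : ∀ n f → (f ⊗ f) (suc (suc n)) ≡ ((f ∘ suc) ⊗ (f ∘ suc)) n
square-step n f = ≡.trans (cong ((f 0 ∧ f (2 ℕ.+ n)) xor_) (⊗-suc n (f ∘ suc) f))
  (≡.trans (≡.sym (xor-assoc (f 0 ∧ f (2 ℕ.+ n)) (f 0 ∧ f (2 ℕ.+ n)) (((f ∘ suc) ⊗ (f ∘ suc)) n)))
    (cong (_xor ((f ∘ suc) ⊗ (f ∘ suc)) n) (xor-same (f 0 ∧ f (2 ℕ.+ n)))))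

square-odd zero    f = ≡.trans (cong ((f 0 ∧ f 1) xor_) (∧-comm (f 1) (f 0))) (xor-same (f 0 ∧ f 1))
square-odd (suc n) f = ≡.trans (square-step (n ℕ.+ suc n) f)
  (≡.trans (cong ((f ∘ suc) ⊗ (f ∘ suc)) (ℕ.+-suc n n)) (square-odd n (f ∘ suc)))

square-even zero    f with f 0
... | true  = ≡.refl
... | false = ≡.refl
square-even (suc n) f = ≡.trans (cong (f ⊗ f) (cong suc (ℕ.+-suc n n)))
  (≡.trans (square-step (n ℕ.+ n) f) (square-even n (f ∘ suc)))

data Parity (n : ℕ) : Set where
  even : ∀ m → m ℕ.+ m ≡ n → Parity n
  odd  : ∀ m → suc (m ℕ.+ m) ≡ n → Parity n

parity : ∀ n → Parity n
parity zero = even 0 ≡.refl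
parity (suc n) with parity n
... | even m eq = odd m (cong suc eq)
... | odd m eq  = even (suc m) (≡.trans (cong suc (ℕ.+-suc m m)) (cong suc eq))

square-supportedOn : ∀ {d f} → SupportedOn d f → SupportedOn (2 ℕ.* d) (f ⊗ f)
square-supportedOn {d} {f} p n eq with parity n
... | even m ≡.refl = subst (2 ℕ.* d ∣_) (cong (m ℕ.+_) (ℕ.+-identityʳ m))
  (*-monoʳ-∣ 2 (p m (≡.trans (≡.sym (square-even m f)) eq)))
... | odd m ≡.refl  = contradiction (≡.trans (≡.sym eq) (square-odd m f)) λ ()

mon : ℕ → Series
mon zero    = 𝟙
mon (suc k) = λ { zero → false ; (suc n) → mon k n }

mon-⊗ : ∀ k f m → (mon k ⊗ f) m ≡ does (k ≤? m) ∧ f (m ∸ k)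
mon-⊗ zero          f m       = ⊗-identityˡ m f
mon-⊗ (suc k)       f zero    = ≡.refl
mon-⊗ (suc zero)    f (suc m) = ⊗-identityˡ m f
mon-⊗ (suc (suc k)) f (suc m) = mon-⊗ (suc k) f m

mon-+ : ∀ j k m → mon (j ℕ.+ k) m ≡ (mon j ⊗ mon k) m
mon-+ zero    k m       = ≡.sym (⊗-identityˡ m (mon k))
mon-+ (suc j) k zero    = ≡.refl
mon-+ (suc j) k (suc m) = mon-+ j k m

mon-does : ∀ k m → mon k m ≡ does (k ℕ.≟ m)
mon-does zero    zero    = ≡.refl
mon-does zero    (suc m) = ≡.refl
mon-does (suc k) zero    = ≡.refl
mon-does (suc k) (suc m) = mon-does k m

geometric : ℕ → Series
geometric k m = does (k ∣? m)

geometric-inverse : ∀ k m → ((𝟙 ⊞ mon (suc k)) ⊗ geometric (suc k)) m ≡ 𝟙 m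
geometric-inverse k m = ≡.trans (⊗-distribʳ m 𝟙 (mon (suc k)) (geometric (suc k)))
  (≡.trans (cong₂ _xor_ (⊗-identityˡ m (geometric (suc k))) (mon-⊗ (suc k) (geometric (suc k)) m)) (cancel m))
  where
  cancel : ∀ m → does (suc k ∣? m) xor (does (suc k ≤? m) ∧ does (suc k ∣? (m ∸ suc k))) ≡ 𝟙 m
  cancel zero = cong (_xor false) (dec-true (suc k ∣? 0) (suc k ∣0))
  cancel (suc m) with suc k ≤? suc m
  ... | no k≰m = cong₂ (λ a b → a xor (b ∧ does (suc k ∣? (suc m ∸ suc k))))
    (dec-false (suc k ∣? suc m) (k≰m ∘ ∣⇒≤)) (dec-false (suc k ≤? suc m) k≰m)
  ... | yes k≤m = ≡.trans
    (cong (does (suc k ∣? suc m) xor_)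
      (≡.trans (cong (_∧ does (suc k ∣? (suc m ∸ suc k))) (dec-true (suc k ≤? suc m) k≤m))
      (does-⇔ (mk⇔ (λ d → ∣m∸n∣n⇒∣m (suc k) k≤m d ∣-refl)
        (λ d → ∣m+n∣m⇒∣n (subst (suc k ∣_) (≡.sym (ℕ.m+[n∸m]≡n k≤m)) d) ∣-refl)) (suc k ∣? (suc m ∸ suc k))
          (suc k ∣? suc m))))
    (xor-same (does (suc k ∣? suc m)))

-- Reduction of the coefficients modulo 2

bit : ℕ → Bool
bit zero    = false
bit (suc n) = not (bit n)

bit-+ : ∀ m n → bit (m ℕ.+ n) ≡ bit m xor bit n
bit-+ zero    n = ≡.refl
bit-+ (suc m) n with bit m | bit-+ m n
... | true  | eq = ≡.trans (cong not eq) (not-involutive _)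
... | false | eq = cong not eq

bit-* : ∀ m n → bit (m ℕ.* n) ≡ bit m ∧ bit n
bit-* zero    n = ≡.refl
bit-* (suc m) n = ≡.trans (bit-+ n (m ℕ.* n)) (≡.trans (cong (bit n xor_) (bit-* m n)) (lem (bit m) (bit n)))
  where
  lem : ∀ a b → b xor (a ∧ b) ≡ not a ∧ b
  lem true  b = xor-same b
  lem false b = xor-identityʳ b

bit-false⇒2∣ : ∀ n → bit n ≡ false → 2 ∣ n
bit-false⇒2∣ n eq with parity n
... | even m ≡.refl = divides m (≡.trans (cong (m ℕ.+_) (≡.sym (ℕ.+-identityʳ m))) (ℕ.*-comm 2 m))
... | odd m ≡.refl  = contradiction (≡.trans (≡.sym (cong not (≡.trans (bit-+ m m) (xor-same (bit m))))) eq) λ ()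

bit-sumTo : ∀ n f → bit (sumTo n f) ≡ ⨁ (suc n) (bit ∘ f)
bit-sumTo zero    f = ≡.refl
bit-sumTo (suc n) f = ≡.trans (bit-+ (sumTo n f) _) (cong (_xor bit (f (suc n))) (bit-sumTo n f))

sumTo-suc : ∀ n f → sumTo (suc n) f ≡ f 0 ℕ.+ sumTo n (f ∘ suc)
sumTo-suc zero    f = ≡.refl
sumTo-suc (suc n) f = ≡.trans (cong (ℕ._+ f (2 ℕ.+ n)) (sumTo-suc n f)) (ℕ.+-assoc (f 0) _ _)

bit-⊛ : ∀ n f g → bit ((f ⊛ g) n) ≡ ((bit ∘ f) ⊗ (bit ∘ g)) n
bit-⊛ zero    f g = bit-* (f 0) (g 0)
bit-⊛ (suc n) f g = ≡.trans (cong bit (sumTo-suc n (λ i → f i ℕ.* g (suc n ∸ i))))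
  (≡.trans (bit-+ (f 0 ℕ.* g (suc n)) _) (cong₂ _xor_ (bit-* (f 0) (g (suc n))) (bit-⊛ n (f ∘ suc) g)))

bit-invOneMinus : ∀ k m → bit (invOneMinus k m) ≡ geometric k m
bit-invOneMinus k m with does (k ∣? m)
... | true  = ≡.refl
... | false = ≡.refl

bit-one : ∀ m → bit (one m) ≡ 𝟙 m
bit-one zero    = ≡.refl
bit-one (suc m) = ≡.refl

bit-shift : ∀ s f m → bit (shift s f m) ≡ (mon s ⊗ (bit ∘ f)) m
bit-shift s f m = ≡.trans (lem (does (s ≤? m))) (≡.sym (mon-⊗ s (bit ∘ f) m))
  where
  lem : ∀ b → bit (if b then f (m ∸ s) else 0) ≡ b ∧ bit (f (m ∸ s))
  lem true  = ≡.refl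
  lem false = ≡.refl

-- With a = 2e + 1 and (e , d) = (3r , 1) or (3r + 2 , 0), progression e d s n says whether q^n occurs in the
-- product of the s-th term of ψ with the r-th term of the Appell-Lerch sum with denominator 1 - q^a.
leading : ℕ → ℕ → ℕ → ℕ
leading e d s = suc (2 ℕ.* e) ℕ.* d ℕ.+ e ℕ.* suc e ℕ.+ 6 ℕ.* triangle s

progression : ℕ → ℕ → ℕ → ℕ → Bool
progression e d s n = does (leading e d s ≤? n) ∧ does (suc (2 ℕ.* e) ∣? (n ∸ leading e d s))

-- The generating function modulo q^(N+1)

module Generating (N : ℕ) where

  open CommutativeSemiring (seriesUpTo N)
  open Char2 (seriesUpTo N) (λ i _ → xor-same (𝟙 i))
  import Relation.Binary.Reasoning.Setoid setoid as ≈
  open ≈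

  pw : ℕ → Series
  pw n = mon (6 ℕ.* n)

  mon-≡ : ∀ {j k} → j ≡ k → mon j ≈ mon k
  mon-≡ ≡.refl = refl

  mon-homo : ∀ j k → mon (j ℕ.+ k) ≈ mon j * mon k
  mon-homo j k i _ = mon-+ j k i

  pw-+ : ∀ m n → pw (m ℕ.+ n) ≈ pw m * pw n
  pw-+ m n = trans (mon-≡ (ℕ.*-distribˡ-+ 6 m n)) (mon-homo (6 ℕ.* m) (6 ℕ.* n))

  p : ℕ → Series
  p zero    = 𝟙
  p (suc n) = p n * geometric (6 ℕ.* suc n)

  inverse : ∀ k → (1# + mon (suc k)) * geometric (suc k) ≈ 1#
  inverse k i _ = geometric-inverse k i

  p-suc : ∀ n → (1# + pw (suc n)) * p (suc n) ≈ p n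
  p-suc n = begin
    x * (p n * y)   ≈⟨ solve 3 (λ x p y → x :* (p :* y) := p :* (x :* y)) refl _ _ _ ⟩
    -- `inverse k` concerns the exponent k + 1, and 6(n + 1) unfolds to the successor of n + 5(n +
    -- 1).
    p n * (x * y)   ≈⟨ *-congˡ (inverse (n ℕ.+ 5 ℕ.* suc n)) ⟩
    p n * 1#        ≈⟨ *-identityʳ _ ⟩
    p n             ∎
    where
    x = 1# + pw (suc n)
    y = geometric (6 ℕ.* suc n)

  p-supportedOn : ∀ n → SupportedOn 6 (p n)
  p-supportedOn zero zero    eq = 6 ∣0
  p-supportedOn (suc n) = ⊗-supportedOn {f = p n} (p-supportedOn n) geometric-supportedOn
    where
    geometric-supportedOn : SupportedOn 6 (geometric (6 ℕ.* suc n))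
    geometric-supportedOn m eq with 6 ℕ.* suc n ∣? m
    ... | yes d = ∣-trans (m∣m*n (suc n)) d
    ... | no ¬d = contradiction (≡.trans (≡.sym eq) (dec-false (6 ℕ.* suc n ∣? m) ¬d)) λ ()

  open Bailey pw refl pw-+ p refl p-suc

  pw-top : pw (suc N) ≈ 0#
  pw-top i i≤N = ≡.trans (mon-does (6 ℕ.* suc N) i)
    (dec-false (6 ℕ.* suc N ℕ.≟ i) λ eq → ℕ.<⇒≢ (ℕ.<-≤-trans (s≤s i≤N) (ℕ.m≤n*m (suc N) 6)) (≡.sym eq))

  open Truncated N pw-top

  -- The partial fractions at x = q, Q/x = q⁵, where d_j = (1 + q^(6j+1))(1 + q^(6j+5)).
  y : Series
  y = mon 1 + mon 5

  h : ℕ → Series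
  h j = geometric (1 ℕ.+ 6 ℕ.* j) * geometric (5 ℕ.+ 6 ℕ.* j)

  A B : ℕ → Series
  A j = mon (1 ℕ.+ 6 ℕ.* j)
  B j = mon (5 ℕ.+ 6 ℕ.* j)

  A*B : ∀ j → A j * B j ≈ pw (suc (2 ℕ.* j))
  A*B j = trans (sym (mon-homo (1 ℕ.+ 6 ℕ.* j) _)) (mon-≡ (lem j))
    where
    lem : ∀ j → 1 ℕ.+ 6 ℕ.* j ℕ.+ (5 ℕ.+ 6 ℕ.* j) ≡ 6 ℕ.* suc (2 ℕ.* j)
    lem = solve-∀

  h-inverse : ∀ j → ((1# + pw (suc (2 ℕ.* j))) + pw j * y) * h j ≈ 1#
  h-inverse j = begin
    ((1# + pw (suc (2 ℕ.* j))) + pw j * y) * h j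
      ≈⟨ *-congʳ (+-cong (+-congˡ {x = 1#} (sym (A*B j))) (trans (distribˡ (pw j) _ _)
           (+-cong (trans (*-comm (pw j) (mon 1)) (sym (mon-homo 1 (6 ℕ.* j))))
             (trans (*-comm (pw j) (mon 5)) (sym (mon-homo 5 (6 ℕ.* j))))))) ⟩
    ((1# + A j * B j) + (A j + B j)) * h j
      ≈⟨ solve 4 (λ a b x y → ((con true :+ a :* b) :+ (a :+ b)) :* (x :* y) := ((con true :+ a) :* x) :*
        ((con true :+ b) :* y)) refl _ _ _ _ ⟩
    ((1# + A j) * geometric (1 ℕ.+ 6 ℕ.* j)) * ((1# + B j) * geometric (5 ℕ.+ 6 ℕ.* j))
      ≈⟨ *-cong (inverse (6 ℕ.* j)) (inverse (4 ℕ.+ 6 ℕ.* j)) ⟩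
    1# * 1#
      ≈⟨ *-identityˡ _ ⟩
    1# ∎

  open PartialFractions y h h-inverse using (H)

  -- With A B = Q^(2r+1) this is (1 - AB)/((1 - A)(1 - B)) = 1/(1 - A) + B/(1 - B). It separates the
  -- denominators a = 6r + 1 and a = 6r + 5.
  e*h : ∀ r → e (suc (2 ℕ.* r)) * h r ≈ geometric (1 ℕ.+ 6 ℕ.* r) + B r * geometric (5 ℕ.+ 6 ℕ.* r)
  e*h r = begin
    e (suc (2 ℕ.* r)) * (u * v)
      ≈⟨ *-congʳ (+-congˡ {x = 1#} (sym (A*B r))) ⟩
    (1# + A r * B r) * (u * v)
      ≈⟨ solve 4 (λ a b u v → (con true :+ a :* b) :* (u :* v) := ((con true :+ b) :* v) :* u :+ b :*
        (v :* ((con true :+ a) :* u))) refl (A r) (B r) u v ⟩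
    ((1# + B r) * v) * u + B r * (v * ((1# + A r) * u))
      ≈⟨ +-cong (trans (*-congʳ (inverse (4 ℕ.+ 6 ℕ.* r))) (*-identityˡ u))
        (*-congˡ (trans (*-congˡ (inverse (6 ℕ.* r))) (*-identityʳ v))) ⟩
    u + B r * v ∎
    where
    u = geometric (1 ℕ.+ 6 ℕ.* r)
    v = geometric (5 ℕ.+ 6 ℕ.* r)

  appell-sum : Series
  appell-sum = range-sum N (λ r → mon 1 * ((T r * pw (r ℕ.* suc r)) * (e (suc (2 ℕ.* r)) * h r)))

  ψ : Series
  ψ = range-sum N T

  p⁴ : Series
  p⁴ = (p N * p N) * (p N * p N)

  ξ-sum : Series
  ξ-sum = range-sum N (λ k → mon 1 * (pw (k ℕ.* suc k) * H k))

  ξ-sum-factors : ξ-sum ≈ (appell-sum * ψ) * p⁴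
  ξ-sum-factors = begin
    ξ-sum
      ≈⟨ range-sum-*ˡ N (mon 1) (λ k → pw (k ℕ.* suc k) * H k) ⟩
    mon 1 * range-sum N (λ k → pw (k ℕ.* suc k) * H k)
      ≈⟨ *-congˡ (appell y h h-inverse) ⟩
    mon 1 * (p N * z)
      ≈⟨ *-congˡ (*-congʳ gauss) ⟩
    mon 1 * ((p⁴ * ψ) * z)
      ≈⟨ solve 4 (λ q p s z → q :* ((p :* s) :* z) := ((q :* z) :* s) :* p) refl (mon 1) p⁴ ψ z ⟩
    ((mon 1 * z) * ψ) * p⁴
      ≈⟨ *-congʳ (*-congʳ (sym (range-sum-*ˡ N (mon 1)
        (λ r → (T r * pw (r ℕ.* suc r)) * (e (suc (2 ℕ.* r)) * h r))))) ⟩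
    (appell-sum * ψ) * p⁴ ∎
    where z = range-sum N (λ r → (T r * pw (r ℕ.* suc r)) * (e (suc (2 ℕ.* r)) * h r))

  range-sum-at : ∀ n (f : ℕ → Series) i → range-sum n f i ≡ ⨁ (suc n) (λ k → f k i)
  range-sum-at zero    f i = ≡.refl
  range-sum-at (suc n) f i = cong (_xor f (suc n) i) (range-sum-at n f i)

  appell-term : ∀ r s → (mon 1 * ((T r * pw (r ℕ.* suc r)) * (e (suc (2 ℕ.* r)) * h r))) * T s
    ≈ mon (leading (3 ℕ.* r) 1 s) * geometric (suc (2 ℕ.* (3 ℕ.* r)))
      + mon (leading (2 ℕ.+ 3 ℕ.* r) 0 s) * geometric (suc (2 ℕ.* (2 ℕ.+ 3 ℕ.* r)))
  appell-term r s = begin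
    (mon 1 * ((T r * pw (r ℕ.* suc r)) * (e (suc (2 ℕ.* r)) * h r))) * T s
      ≈⟨ *-congʳ (*-congˡ (*-congˡ (e*h r))) ⟩
    (mon 1 * ((T r * pw (r ℕ.* suc r)) * (u + B r * v))) * T s
      ≈⟨ solve 7 (λ q t w u b v t′ → (q :* ((t :* w) :* (u :+ b :* v))) :* t′ := (q :* (t :* (w :* t′))) :* u :+
        (q :* (t :* (w :* (t′ :* b)))) :* v) refl (mon 1) (T r) (pw (r ℕ.* suc r)) u (B r) v (T s) ⟩
    (mon 1 * (T r * (pw (r ℕ.* suc r) * T s))) * u + (mon 1 * (T r * (pw (r ℕ.* suc r) * (T s * B r)))) * v
      ≈⟨ +-cong (*-cong exponent₁ (reflexive (cong geometric (lem₁ r))))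
        (*-cong exponent₂ (reflexive (cong geometric (lem₂ r)))) ⟩
    mon (leading (3 ℕ.* r) 1 s) * geometric (suc (2 ℕ.* (3 ℕ.* r)))
      + mon (leading (2 ℕ.+ 3 ℕ.* r) 0 s) * geometric (suc (2 ℕ.* (2 ℕ.+ 3 ℕ.* r))) ∎
    where
    u = geometric (1 ℕ.+ 6 ℕ.* r)
    v = geometric (5 ℕ.+ 6 ℕ.* r)
    lem₁ : ∀ r → 1 ℕ.+ 6 ℕ.* r ≡ suc (2 ℕ.* (3 ℕ.* r))
    lem₁ = solve-∀
    lem₂ : ∀ r → 5 ℕ.+ 6 ℕ.* r ≡ suc (2 ℕ.* (2 ℕ.+ 3 ℕ.* r))
    lem₂ = solve-∀
    six : 6 ℕ.* triangle r ≡ 3 ℕ.* (r ℕ.* suc r)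
    six = ≡.trans (ℕ.*-assoc 3 2 (triangle r)) (cong (3 ℕ.*_) (double-triangle r))
    ix₁ : ∀ r t → 1 ℕ.+ (3 ℕ.* (r ℕ.* suc r) ℕ.+ (6 ℕ.* (r ℕ.* suc r) ℕ.+ t))
      ≡ suc (2 ℕ.* (3 ℕ.* r)) ℕ.* 1 ℕ.+ (3 ℕ.* r) ℕ.* suc (3 ℕ.* r) ℕ.+ t
    ix₁ = solve-∀
    ix₂ : ∀ r t → 1 ℕ.+ (3 ℕ.* (r ℕ.* suc r) ℕ.+ (6 ℕ.* (r ℕ.* suc r) ℕ.+ (t ℕ.+ (5 ℕ.+ 6 ℕ.* r))))
      ≡ suc (2 ℕ.* (2 ℕ.+ 3 ℕ.* r)) ℕ.* 0 ℕ.+ (2 ℕ.+ 3 ℕ.* r) ℕ.* suc (2 ℕ.+ 3 ℕ.* r) ℕ.+ t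
    ix₂ = solve-∀
    exponent₁ : mon 1 * (T r * (pw (r ℕ.* suc r) * T s)) ≈ mon (leading (3 ℕ.* r) 1 s)
    exponent₁ = begin
      mon 1 * (T r * (pw (r ℕ.* suc r) * T s))
        ≈⟨ *-congˡ (trans (*-congˡ (sym (mon-homo (6 ℕ.* (r ℕ.* suc r)) _))) (sym (mon-homo (6 ℕ.* triangle r) _))) ⟩
      mon 1 * mon (6 ℕ.* triangle r ℕ.+ (6 ℕ.* (r ℕ.* suc r) ℕ.+ 6 ℕ.* triangle s))
        ≈⟨ sym (mon-homo 1 _) ⟩
      mon (1 ℕ.+ (6 ℕ.* triangle r ℕ.+ (6 ℕ.* (r ℕ.* suc r) ℕ.+ 6 ℕ.* triangle s)))
        ≈⟨ mon-≡ (≡.trans (cong (λ x → 1 ℕ.+ (x ℕ.+ (6 ℕ.* (r ℕ.* suc r) ℕ.+ 6 ℕ.* triangle s))) six) (ix₁ r _)) ⟩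
      mon (leading (3 ℕ.* r) 1 s) ∎
    exponent₂ : mon 1 * (T r * (pw (r ℕ.* suc r) * (T s * B r))) ≈ mon (leading (2 ℕ.+ 3 ℕ.* r) 0 s)
    exponent₂ = begin
      mon 1 * (T r * (pw (r ℕ.* suc r) * (T s * B r)))
        ≈⟨ *-congˡ (trans (*-congˡ (trans (*-congˡ (sym (mon-homo (6 ℕ.* triangle s) _)))
          (sym (mon-homo (6 ℕ.* (r ℕ.* suc r)) _)))) (sym (mon-homo (6 ℕ.* triangle r) _))) ⟩
      mon 1 * mon (6 ℕ.* triangle r ℕ.+ (6 ℕ.* (r ℕ.* suc r) ℕ.+ (6 ℕ.* triangle s ℕ.+ (5 ℕ.+ 6 ℕ.* r))))
        ≈⟨ sym (mon-homo 1 _) ⟩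
      mon (1 ℕ.+ (6 ℕ.* triangle r ℕ.+ (6 ℕ.* (r ℕ.* suc r) ℕ.+ (6 ℕ.* triangle s ℕ.+ (5 ℕ.+ 6 ℕ.* r)))))
        ≈⟨ mon-≡ (≡.trans (cong (λ x → 1 ℕ.+
          (x ℕ.+ (6 ℕ.* (r ℕ.* suc r) ℕ.+ (6 ℕ.* triangle s ℕ.+ (5 ℕ.+ 6 ℕ.* r))))) six) (ix₂ r _)) ⟩
      mon (leading (2 ℕ.+ 3 ℕ.* r) 0 s) ∎

  appell-ψ-at : ∀ i → i ℕ.≤ N → (appell-sum * ψ) i ≡
    ⨁ (suc N) (λ r → ⨁ (suc N) (λ s → progression (3 ℕ.* r) 1 s i xor progression (2 ℕ.+ 3 ℕ.* r) 0 s i))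
  appell-ψ-at i i≤N = ≡.trans (sums i i≤N)
    (≡.trans (range-sum-at N _ i) (⨁-cong (suc N) λ r _ → ≡.trans (range-sum-at N _ i)
    (⨁-cong (suc N) λ s _ → cong₂ _xor_ (mon-⊗ (leading (3 ℕ.* r) 1 s) _ i)
      (mon-⊗ (leading (2 ℕ.+ 3 ℕ.* r) 0 s) _ i))))
    where
    c : ℕ → Series
    c r = mon 1 * ((T r * pw (r ℕ.* suc r)) * (e (suc (2 ℕ.* r)) * h r))
    term : ℕ → ℕ → Series
    term r s = mon (leading (3 ℕ.* r) 1 s) * geometric (suc (2 ℕ.* (3 ℕ.* r)))
      + mon (leading (2 ℕ.+ 3 ℕ.* r) 0 s) * geometric (suc (2 ℕ.* (2 ℕ.+ 3 ℕ.* r)))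
    sums : appell-sum * ψ ≈ range-sum N (λ r → range-sum N (term r))
    sums = begin
      appell-sum * ψ
        ≈⟨ trans (*-comm _ _) (sym (range-sum-*ˡ N ψ c)) ⟩
      range-sum N (λ r → ψ * c r)
        ≈⟨ range-sum-cong N (λ r → trans (*-comm ψ (c r)) (sym (range-sum-*ˡ N (c r) T))) ⟩
      range-sum N (λ r → range-sum N (λ s → c r * T s))
        ≈⟨ range-sum-cong N (λ r → range-sum-cong N (λ s → appell-term r s)) ⟩
      range-sum N (λ r → range-sum N (term r)) ∎

  range-sum-square : ∀ n f → range-sum n f * range-sum n f ≈ range-sum n (λ i → f i * f i)
  range-sum-square zero    f = refl
  range-sum-square (suc n) f = trans
    (solve 2 (λ a b → (a :+ b) :* (a :+ b) := a :* a :+ b :* b) refl (range-sum n f) (f (suc n)))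
    (+-congʳ (range-sum-square n f))

  ψ⁴ : Series
  ψ⁴ = (ψ * ψ) * (ψ * ψ)

  ψ⁴-at : ∀ i → i ℕ.≤ N → (mon 2 * ψ⁴) i ≡ ⨁ (suc N) (λ s → does (2 ℕ.+ 24 ℕ.* triangle s ℕ.≟ i))
  ψ⁴-at i i≤N = ≡.trans (sums i i≤N)
    (≡.trans (range-sum-at N _ i) (⨁-cong (suc N) λ s _ → mon-does (2 ℕ.+ 24 ℕ.* triangle s) i))
    where
    lem : ∀ t → 2 ℕ.+ (6 ℕ.* t ℕ.+ 6 ℕ.* t ℕ.+ (6 ℕ.* t ℕ.+ 6 ℕ.* t)) ≡ 2 ℕ.+ 24 ℕ.* t
    lem = solve-∀
    fourth : ∀ s → mon 2 * ((T s * T s) * (T s * T s)) ≈ mon (2 ℕ.+ 24 ℕ.* triangle s)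
    fourth s = begin
      mon 2 * ((T s * T s) * (T s * T s))
        ≈⟨ *-congˡ (trans (*-cong tt tt) (sym (mon-homo (6 ℕ.* t ℕ.+ 6 ℕ.* t) _))) ⟩
      mon 2 * mon (6 ℕ.* t ℕ.+ 6 ℕ.* t ℕ.+ (6 ℕ.* t ℕ.+ 6 ℕ.* t))
        ≈⟨ sym (mon-homo 2 _) ⟩
      mon (2 ℕ.+ (6 ℕ.* t ℕ.+ 6 ℕ.* t ℕ.+ (6 ℕ.* t ℕ.+ 6 ℕ.* t)))
        ≈⟨ mon-≡ (lem t) ⟩
      mon (2 ℕ.+ 24 ℕ.* t) ∎
      where
      t = triangle s
      tt = sym (mon-homo (6 ℕ.* t) (6 ℕ.* t))
    sums : mon 2 * ψ⁴ ≈ range-sum N (λ s → mon (2 ℕ.+ 24 ℕ.* triangle s))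
    sums = begin
      mon 2 * ψ⁴
        ≈⟨ *-congˡ (trans (*-cong (range-sum-square N T) (range-sum-square N T))
          (range-sum-square N (λ s → T s * T s))) ⟩
      mon 2 * range-sum N (λ s → (T s * T s) * (T s * T s))
        ≈⟨ sym (range-sum-*ˡ N (mon 2) _) ⟩
      range-sum N (λ s → mon 2 * ((T s * T s) * (T s * T s)))
        ≈⟨ range-sum-cong N fourth ⟩
      range-sum N (λ s → mon (2 ℕ.+ 24 ℕ.* triangle s)) ∎

  p⁴-supportedOn : SupportedOn 24 p⁴
  p⁴-supportedOn = square-supportedOn {f = p N * p N} (square-supportedOn {f = p N} (p-supportedOn N))

  eighth-power : Series
  eighth-power = let x = ψ * (p N * p N) in ((x * x) * (x * x)) * ((x * x) * (x * x))

  -- Multiplied by ψ, Gauss's identity says that ψ p = (ψ p²)² is itself a square. This doubles the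
  -- modulus 24, which is visible at once, to 48.
  ψ⁴p⁴ : ψ⁴ * p⁴ ≈ eighth-power
  ψ⁴p⁴ = trans
    (solve 2 (λ s p → ((s :* s) :* (s :* s)) :* ((p :* p) :* (p :* p)) := ((s :* p) :* (s :* p)) :*
      ((s :* p) :* (s :* p))) refl ψ (p N))
    (trans (*-cong (*-cong ψp ψp) (*-cong ψp ψp))
      (solve 2 (λ s p → let x = s :* p ; x² = x :* x in (x² :* x²) :* (x² :* x²) := ((x :* x) :* (x :* x)) :*
        ((x :* x) :* (x :* x))) refl ψ (p N * p N)))
    where
    ψp : ψ * p N ≈ (ψ * (p N * p N)) * (ψ * (p N * p N))
    ψp = trans (*-congˡ gauss) (solve 2
      (λ s p → s :* (((p :* p) :* (p :* p)) :* s) := (s :* (p :* p)) :* (s :* (p :* p))) refl ψ (p N))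

  ψ-supportedOn : SupportedOn 6 ψ
  ψ-supportedOn = partial N
    where
    T-supportedOn : ∀ s → SupportedOn 6 (T s)
    T-supportedOn s m eq with 6 ℕ.* triangle s ℕ.≟ m
    ... | yes ≡.refl = m∣m*n (triangle s)
    ... | no ≢       = contradiction
      (≡.trans (≡.sym eq) (≡.trans (mon-does (6 ℕ.* triangle s) m) (dec-false (6 ℕ.* triangle s ℕ.≟ m) ≢))) λ ()
    partial : ∀ n → SupportedOn 6 (range-sum n T)
    partial zero    = T-supportedOn 0
    partial (suc n) m eq with range-sum n T m in eq₁ | T (suc n) m in eq₂
    ... | true  | _    = partial n m eq₁
    ... | false | true = T-supportedOn (suc n) m eq₂

  eighth-power-supportedOn : SupportedOn 48 eighth-power
  eighth-power-supportedOn = square-supportedOn {f = (x * x) * (x * x)}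
    (square-supportedOn {f = x * x} (square-supportedOn {f = x}
    (⊗-supportedOn {f = ψ} ψ-supportedOn (⊗-supportedOn {f = p N} (p-supportedOn N) (p-supportedOn N)))))
    where x = ψ * (p N * p N)

  reciprocal : ℕ → ℕ → Series
  reciprocal a n = bit ∘ invPoch6 a n

  reciprocal-suc : ∀ a n → reciprocal a (suc n) ≈ reciprocal a n * geometric (a ℕ.+ 6 ℕ.* n)
  reciprocal-suc a n i _ = ≡.trans (bit-⊛ i (invPoch6 a n) (invOneMinus (a ℕ.+ 6 ℕ.* n)))
    (⊗-cong i (λ _ _ → ≡.refl) (λ j _ → bit-invOneMinus (a ℕ.+ 6 ℕ.* n) j))

  reciprocal-H : ∀ k → reciprocal 1 (suc k) * reciprocal 5 (suc k) ≈ H k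
  reciprocal-H zero = begin
    reciprocal 1 1 * reciprocal 5 1
      ≈⟨ *-cong (reciprocal-suc 1 0) (reciprocal-suc 5 0) ⟩
    (reciprocal 1 0 * geometric 1) * (reciprocal 5 0 * geometric 5)
      ≈⟨ *-cong (*-congʳ {x = geometric 1} (λ i _ → bit-one i)) (*-congʳ {x = geometric 5} (λ i _ → bit-one i)) ⟩
    (1# * geometric 1) * (1# * geometric 5)
      ≈⟨ *-cong (*-identityˡ (geometric 1)) (*-identityˡ (geometric 5)) ⟩
    geometric 1 * geometric 5 ∎
  reciprocal-H (suc k) = begin
    reciprocal 1 (2 ℕ.+ k) * reciprocal 5 (2 ℕ.+ k)
      ≈⟨ *-cong (reciprocal-suc 1 (suc k)) (reciprocal-suc 5 (suc k)) ⟩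
    (reciprocal 1 (suc k) * u) * (reciprocal 5 (suc k) * v)
      ≈⟨ solve 4 (λ a u b v → (a :* u) :* (b :* v) := (a :* b) :* (u :* v)) refl (reciprocal 1 (suc k)) u
        (reciprocal 5 (suc k)) v ⟩
    (reciprocal 1 (suc k) * reciprocal 5 (suc k)) * (u * v)
      ≈⟨ *-congʳ (reciprocal-H k) ⟩
    H k * (u * v) ∎
    where
    u = geometric (1 ℕ.+ 6 ℕ.* suc k)
    v = geometric (5 ℕ.+ 6 ℕ.* suc k)

  ξterm-bit : ∀ k → bit ∘ ξterm k ≈ mon 1 * (pw (k ℕ.* suc k) * H k)
  ξterm-bit k = begin
    bit ∘ ξterm k
      ≈⟨ (λ i _ → bit-shift (6 ℕ.* k ℕ.* k ℕ.+ 6 ℕ.* k ℕ.+ 1) (invPoch6 1 (suc k) ⊛ invPoch6 5 (suc k)) i) ⟩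
    mon (6 ℕ.* k ℕ.* k ℕ.+ 6 ℕ.* k ℕ.+ 1) * (bit ∘ (invPoch6 1 (suc k) ⊛ invPoch6 5 (suc k)))
      ≈⟨ *-cong (trans (mon-≡ (lem k)) (mon-homo 1 (6 ℕ.* (k ℕ.* suc k))))
        (trans (λ i _ → bit-⊛ i (invPoch6 1 (suc k)) (invPoch6 5 (suc k))) (reciprocal-H k)) ⟩
    (mon 1 * pw (k ℕ.* suc k)) * H k
      ≈⟨ *-assoc (mon 1) (pw (k ℕ.* suc k)) (H k) ⟩
    mon 1 * (pw (k ℕ.* suc k) * H k) ∎
    where
    lem : ∀ k → 6 ℕ.* k ℕ.* k ℕ.+ 6 ℕ.* k ℕ.+ 1 ≡ 1 ℕ.+ 6 ℕ.* (k ℕ.* suc k)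
    lem = solve-∀

  ξ-bit : bit (sumTo N (λ k → ξterm k N)) ≡ ξ-sum N
  ξ-bit = ≡.trans (bit-sumTo N (λ k → ξterm k N))
    (≡.trans (⨁-cong (suc N) λ k _ → ξterm-bit k N ℕ.≤-refl)
      (≡.sym (range-sum-at N (λ k → mon 1 * (pw (k ℕ.* suc k) * H k)) N)))

  xor≡false⇒≡ : ∀ a b → a xor b ≡ false → a ≡ b
  xor≡false⇒≡ true  true  _ = ≡.refl
  xor≡false⇒≡ false false _ = ≡.refl

  module _ (agree : ∀ i → i ℕ.≤ N → i % 4 ≡ 2 → (appell-sum * ψ) i ≡ (mon 2 * ψ⁴) i) where

    -- Exponents of `p⁴` are multiples of 24, hence of 4, so the coefficient at N ≡ 2 (mod 4)
    -- involves the other factor only at exponents i ≡ 2 (mod 4), where `agree` applies.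
    leading-part : N % 4 ≡ 2 → ξ-sum N ≡ ((mon 2 * ψ⁴) * p⁴) N
    leading-part N%4 = ≡.trans (ξ-sum-factors N ℕ.≤-refl) (xor≡false⇒≡ _ _
      (≡.trans (≡.sym (⊗-distribʳ N (appell-sum * ψ) (mon 2 * ψ⁴) p⁴)) difference))
      where
      difference : (((appell-sum * ψ) + (mon 2 * ψ⁴)) * p⁴) N ≡ false
      difference = ¬-not λ eq → cancel (⊗-support N ((appell-sum * ψ) + (mon 2 * ψ⁴)) p⁴ eq)
        where
        cancel : ¬ ∃ λ i → ∃ λ j → i ℕ.+ j ≡ N × ((appell-sum * ψ) + (mon 2 * ψ⁴)) i ≡ true × p⁴ j ≡ true
        cancel (i , j , i+j≡N , at-i , at-j) = contradiction (≡.trans (≡.sym at-i)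
          (≡.trans (cong (_xor (mon 2 * ψ⁴) i)
            (agree i (ℕ.m+n≤o⇒m≤o i (ℕ.≤-reflexive i+j≡N)) (i%4 (p⁴-supportedOn j at-j))))
            (xor-same ((mon 2 * ψ⁴) i)))) λ ()
          where
          i%4 : 24 ∣ j → i % 4 ≡ 2
          i%4 (divides q j≡) = ≡.trans (≡.sym ([m+kn]%n≡m%n i (q ℕ.* 6) 4))
            (≡.trans (cong (λ x → (i ℕ.+ x) % 4) (≡.trans (ℕ.*-assoc q 6 4) (≡.sym j≡)))
              (≡.trans (cong (_% 4) i+j≡N) N%4))

    ξ-sum-vanishes : N % 4 ≡ 2 → ¬ 48 ∣ N ∸ 2 → ξ-sum N ≡ false
    ξ-sum-vanishes N%4 48∤ = ¬-not λ eq → 48∤ (eighth-power-supportedOn (N ∸ 2) (at eq))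
      where
      ∧-true : ∀ a {b} → a ∧ b ≡ true → b ≡ true
      ∧-true true eq = eq
      at : ξ-sum N ≡ true → eighth-power (N ∸ 2) ≡ true
      at eq = ∧-true (does (2 ≤? N)) (≡.trans (≡.sym (mon-⊗ 2 eighth-power N))
        (≡.trans (≡.sym (⊗-cong N {f = mon 2} (λ _ _ → ≡.refl) ψ⁴p⁴))
        (≡.trans (≡.sym (⊗-assoc N (mon 2) ψ⁴ p⁴))
        (≡.trans (≡.sym (leading-part N%4)) eq))))

-- Finite sums over 𝔽₂

open import Data.Nat using (_+_; _*_; _≤_; _<_; _≟_; NonZero)
open import Relation.Binary.PropositionalEquality using (_≢_; refl; sym; trans; subst₂)

⨁-zero : ∀ n {f} → (∀ i → i < n → f i ≡ false) → ⨁ n f ≡ false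
⨁-zero zero    h = refl
⨁-zero (suc n) h = cong₂ _xor_ (⨁-zero n λ i i<n → h i (ℕ.m<n⇒m<1+n i<n)) (h n ℕ.≤-refl)

⨁-xor : ∀ n f g → ⨁ n (λ i → f i xor g i) ≡ ⨁ n f xor ⨁ n g
⨁-xor zero    f g = refl
⨁-xor (suc n) f g = trans (cong (_xor (f n xor g n)) (⨁-xor n f g)) (xor-interchange (⨁ n f) (⨁ n g) (f n) (g n))

⨁-swap : ∀ m n (f : ℕ → ℕ → Bool) → ⨁ m (λ i → ⨁ n (f i)) ≡ ⨁ n (λ j → ⨁ m (λ i → f i j))
⨁-swap zero    n f = sym (⨁-zero n λ _ _ → refl)
⨁-swap (suc m) n f = trans (cong (_xor ⨁ n (f m)) (⨁-swap m n f)) (sym (⨁-xor n (λ j → ⨁ m (λ i → f i j)) (f m)))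

⨁-+ : ∀ m n f → ⨁ (m + n) f ≡ ⨁ m f xor ⨁ n (λ i → f (m + i))
⨁-+ m zero    f = trans (cong (λ k → ⨁ k f) (ℕ.+-identityʳ m)) (sym (xor-identityʳ (⨁ m f)))
⨁-+ m (suc n) f = trans (cong (λ k → ⨁ k f) (ℕ.+-suc m n))
  (trans (cong (_xor f (m + n)) (⨁-+ m n f)) (xor-assoc (⨁ m f) (⨁ n (λ i → f (m + i))) (f (m + n))))

⨁-suc : ∀ n f → ⨁ (suc n) f ≡ f 0 xor ⨁ n (f ∘ suc)
⨁-suc n f = ⨁-+ 1 n f

⨁-extend : ∀ {m n f} → (∀ i → m ≤ i → f i ≡ false) → m ≤ n → ⨁ n f ≡ ⨁ m f
⨁-extend {m} {n} {f} h m≤n = trans (cong (λ k → ⨁ k f) (sym (ℕ.m+[n∸m]≡n m≤n)))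
  (trans (⨁-+ m (n ∸ m) f) (trans (cong (⨁ m f xor_) (⨁-zero (n ∸ m) λ i _ → h (m + i) (ℕ.m≤m+n m i)))
    (xor-identityʳ (⨁ m f))))

⨁-single : ∀ {n f} j → j < n → (∀ i → i ≢ j → f i ≡ false) → ⨁ n f ≡ f j
⨁-single {n} {f} j j<n h = trans (cong (λ k → ⨁ k f) (sym (ℕ.m+[n∸m]≡n j<n)))
  (trans (⨁-+ (suc j) (n ∸ suc j) f) (trans (cong₂ (λ a b → (a xor f j) xor b)
    (⨁-zero j λ i i<j → h i (ℕ.<⇒≢ i<j))
    (⨁-zero (n ∸ suc j) λ i _ → h (suc j + i) (ℕ.>⇒≢ (s≤s (ℕ.m≤m+n j i))))) (xor-identityʳ (f j))))

⨁-reverse : ∀ n {f g} → (∀ i j → suc (i + j) ≡ n → f i ≡ g j) → ⨁ n f ≡ ⨁ n g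
⨁-reverse zero    h = refl
⨁-reverse (suc n) {f} {g} h = trans
  (cong₂ _xor_ (⨁-reverse n λ i j eq → h i (suc j) (cong suc (trans (ℕ.+-suc i j) eq)))
    (h n 0 (cong suc (ℕ.+-identityʳ n))))
  (trans (xor-comm (⨁ n (g ∘ suc)) (g 0)) (sym (⨁-suc n g)))

-- The reflection of an even number of indices has no fixed point, so equal terms cancel in pairs.
⨁-reflect : ∀ m {f} → (∀ i j → suc (i + j) ≡ m + m → f i ≡ f j) → ⨁ (m + m) f ≡ false
⨁-reflect m {f} h = trans (⨁-+ m m f) (trans
  (cong (_xor ⨁ m (λ i → f (m + i))) (⨁-reverse m λ i j eq → h i (m + j) (trans (lem i j) (cong (m +_) eq))))
  (xor-same (⨁ m (λ i → f (m + i)))))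
  where
  lem : ∀ i j → suc (i + (m + j)) ≡ m + suc (i + j)
  lem i j = trans (cong suc (trans (sym (ℕ.+-assoc i m j))
    (trans (cong (_+ j) (ℕ.+-comm i m)) (ℕ.+-assoc m i j)))) (sym (ℕ.+-suc m (i + j)))

⨁-periodic : ∀ h m {f} → (∀ i → f (h + i) ≡ f i) → ⨁ h (λ i → f (m + i)) ≡ ⨁ h f
⨁-periodic h zero    p = refl
⨁-periodic h (suc m) {f} p = trans (⨁-cong h λ i _ → cong f (sym (ℕ.+-suc m i)))
  (trans (shift-by-one h (λ i → trans (cong f (lem m i)) (p (m + i)))) (⨁-periodic h m {f} p))
  where
  lem : ∀ m i → m + (h + i) ≡ h + (m + i)
  lem m i = trans (sym (ℕ.+-assoc m h i)) (trans (cong (_+ i) (ℕ.+-comm m h)) (ℕ.+-assoc h m i))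
  shift-by-one : ∀ h {g : ℕ → Bool} → (∀ i → g (h + i) ≡ g i) → ⨁ h (g ∘ suc) ≡ ⨁ h g
  shift-by-one h {g} p = begin
    ⨁ h (g ∘ suc)                        ≡⟨ xor-cancel (g 0) (⨁ h (g ∘ suc)) ⟨
    g 0 xor (g 0 xor ⨁ h (g ∘ suc))      ≡⟨ cong (g 0 xor_) (⨁-suc h g) ⟨
    g 0 xor (⨁ h g xor g h)              ≡⟨ cong (λ b → g 0 xor (⨁ h g xor b))
      (trans (cong g (sym (ℕ.+-identityʳ h))) (p 0)) ⟩
    g 0 xor (⨁ h g xor g 0)              ≡⟨ cong (g 0 xor_) (xor-comm (⨁ h g) (g 0)) ⟩
    g 0 xor (g 0 xor ⨁ h g)              ≡⟨ xor-cancel (g 0) (⨁ h g) ⟩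
    ⨁ h g                                ∎
    where
    open ≡.≡-Reasoning
    xor-cancel : ∀ a b → a xor (a xor b) ≡ b
    xor-cancel false b = refl
    xor-cancel true  b = not-involutive b

⨁-even-odd : ∀ n f → ⨁ (n + n) f ≡ ⨁ n (λ k → f (k + k)) xor ⨁ n (λ k → f (suc (k + k)))
⨁-even-odd zero    f = refl
⨁-even-odd (suc n) f = trans (cong (λ k → ⨁ (suc k) f) (ℕ.+-suc n n))
  (trans (xor-assoc (⨁ (n + n) f) _ _) (trans (cong (_xor (f (n + n) xor f (suc (n + n)))) (⨁-even-odd n f))
    (xor-interchange (⨁ n (λ k → f (k + k))) _ _ _)))

-- Lattice points on conics

odd-number : ℕ → ℕ
odd-number k = suc (k + k)

-- Lattice points (a , z , X) with X, respectively -Y, on the conic n + 1 = 3z² + aX; the last one has z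
-- replaced by -z.
module Points (n : ℕ) where

  Right? : ∀ a d z X → Dec (suc n ≡ 3 * (z * z) + a * X × a + d ≤ X + 3 * z)
  Right? a d z X = (suc n ≟ 3 * (z * z) + a * X) ×-dec (a + d ≤? X + 3 * z)

  Below? : ∀ a d z Y → Dec (suc n + a * Y ≡ 3 * (z * z) × a + d + Y ≤ 3 * z)
  Below? a d z Y = (suc n + a * Y ≟ 3 * (z * z)) ×-dec (a + d + Y ≤? 3 * z)

  Left? : ∀ a d z X → Dec (suc n ≡ 3 * (z * z) + a * X × a + d + 3 * z ≤ X)
  Left? a d z X = (suc n ≟ 3 * (z * z) + a * X) ×-dec (a + d + 3 * z ≤? X)

  -- A common bound: X ≤ n + 1 on the conic, and Y ≤ 3z with z ≤ e + s + 1 ≤ 2n + 1.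
  K : ℕ
  K = 3 * suc (n + n)

  -- Starting from `suc Y` keeps X = 0 from being counted twice. For -z the inequality already
  -- forces X > 0, so there is no sum over points below.
  positive negative : ℕ → ℕ → ℕ → Bool
  positive a d z = ⨁ (suc K) (λ X → does (Right? a d z X)) xor ⨁ K (λ Y → does (Below? a d z (suc Y)))
  negative a d z = ⨁ (suc K) (λ X → does (Left? a d z X))

  -- The witness i is the index in the geometric series. Since `map′` and `×-dec` compute on `does`,
  -- the boolean of this decision is `progression e d s n` by definition.
  Progression? : ∀ e d s → Dec (∃ λ i → n ≡ leading e d s + i * suc (2 * e))
  Progression? e d s = map′
    (λ { (l≤n , divides i eq) → i , trans (sym (ℕ.m+[n∸m]≡n l≤n)) (cong (leading e d s +_) eq) })
    (λ { (i , eq) → ℕ.m+n≤o⇒m≤o (leading e d s) (ℕ.≤-reflexive (sym eq)) , divides i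
      (trans (cong (_∸ leading e d s) eq) (ℕ.m+n∸m≡n (leading e d s) _)) })
    ((leading e d s ≤? n) ×-dec (suc (2 * e) ∣? (n ∸ leading e d s)))

  e≤leading : ∀ e d s → e ≤ leading e d s
  e≤leading e d s = ℕ.≤-trans (ℕ.m≤m*n e (suc e))
    (ℕ.≤-trans (ℕ.m≤n+m (e * suc e) (suc (2 * e) * d)) (ℕ.m≤m+n (suc (2 * e) * d + e * suc e) (6 * triangle s)))

  s≤leading : ∀ e d s → s ≤ leading e d s
  s≤leading e d s = ℕ.≤-trans (triangle-≥ s)
    (ℕ.≤-trans (ℕ.m≤n*m (triangle s) 6) (ℕ.m≤n+m (6 * triangle s) (suc (2 * e) * d + e * suc e)))

  leading≤n : ∀ e d s i → n ≡ leading e d s + i * suc (2 * e) → leading e d s ≤ n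
  leading≤n e d s i eq = ℕ.m+n≤o⇒m≤o (leading e d s) (ℕ.≤-reflexive (sym eq))

  progression-large-e : ∀ e d s → n < e → progression e d s n ≡ false
  progression-large-e e d s n<e = dec-false (Progression? e d s) λ (i , eq)
    → ℕ.<⇒≱ n<e (ℕ.≤-trans (e≤leading e d s) (leading≤n e d s i eq))

  progression-large-s : ∀ e d s → n < s → progression e d s n ≡ false
  progression-large-s e d s n<s = dec-false (Progression? e d s) λ (i , eq)
    → ℕ.<⇒≱ n<s (ℕ.≤-trans (s≤leading e d s) (leading≤n e d s i eq))

  6*triangle : ∀ s → 6 * triangle s ≡ 3 * (s * suc s)
  6*triangle s = trans (ℕ.*-assoc 3 2 (triangle s)) (cong (3 *_) (double-triangle s))

  leading-≡ : ∀ e d s → leading e d s ≡ suc (2 * e) * d + e * suc e + 3 * (s * suc s)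
  leading-≡ e d s = cong (suc (2 * e) * d + e * suc e +_) (6*triangle s)

  X≤K : ∀ z e X → suc n ≡ 3 * (z * z) + suc (2 * e) * X → X ≤ K
  X≤K z e X eq = ℕ.≤-trans (ℕ.≤-trans (ℕ.m≤n*m X (suc (2 * e)))
    (ℕ.≤-trans (ℕ.m≤n+m _ (3 * (z * z))) (ℕ.≤-reflexive (sym eq))))
    (ℕ.≤-trans (s≤s (ℕ.m≤m+n n n)) (ℕ.m≤n*m (suc (n + n)) 3))

  X-unique : ∀ z e X X′ → suc n ≡ 3 * (z * z) + suc (2 * e) * X → suc n ≡ 3 * (z * z) + suc (2 * e) * X′ → X ≡ X′
  X-unique z e X X′ p q = ℕ.*-cancelˡ-≡ X X′ (suc (2 * e)) (ℕ.+-cancelˡ-≡ (3 * (z * z)) _ _ (trans (sym p) q))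

  above-below : ∀ z e X Y → suc n ≡ 3 * (z * z) + suc (2 * e) * X → suc n + suc (2 * e) * suc Y ≢ 3 * (z * z)
  above-below z e X Y p q = ℕ.m+1+n≢m (3 * (z * z)) {e′}
    (trans (trans (lem (3 * (z * z)) e X Y) (cong (_+ suc (2 * e) * suc Y) (sym p))) q)
    where
    e′ = suc (2 * e) * X + Y + 2 * e * suc Y
    lem : ∀ w e X Y → w + suc (suc (2 * e) * X + Y + 2 * e * suc Y) ≡ w + suc (2 * e) * X + suc (2 * e) * suc Y
    lem = solve-∀

  -- The equation is the conic at i = 0, with 3za moved to the left. Adding ia to both sides gives X
  -- = a + d + i - 3z, whose sign decides whether i is met by `Right?` or by `Below?`, in either
  -- case exactly once. The bound on z keeps Y within `K`.
  positive-progression : ∀ e d s z → z ≤ suc (e + s) →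
    suc (leading e d s) + 3 * z * suc (2 * e) ≡ 3 * (z * z) + suc (2 * e) * (suc (2 * e) + d) →
    positive (suc (2 * e)) d z ≡ progression e d s n
  positive-progression e d s z z≤ J = go (Progression? e d s)
    where
    a = suc (2 * e)
    lem₁ : ∀ l x y → suc (l + x) + y ≡ suc l + y + x
    lem₁ = solve-∀
    lem₂ : ∀ w a d i → w + a * (a + d) + i * a ≡ w + a * (a + d + i)
    lem₂ = solve-∀
    toE : ∀ i → n ≡ leading e d s + i * a → suc n + 3 * z * a ≡ 3 * (z * z) + a * (a + d + i)
    toE i eq = trans (cong (λ x → suc x + 3 * z * a) eq) (trans (lem₁ (leading e d s) (i * a) (3 * z * a))
      (trans (cong (_+ i * a) J) (lem₂ (3 * (z * z)) a d i)))
    fromE : ∀ i → suc n + 3 * z * a ≡ 3 * (z * z) + a * (a + d + i) → n ≡ leading e d s + i * a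
    fromE i eq = ℕ.suc-injective (ℕ.+-cancelʳ-≡ (3 * z * a) _ _ (trans eq (trans (sym (lem₂ (3 * (z * z)) a d i))
      (trans (cong (_+ i * a) (sym J)) (sym (lem₁ (leading e d s) (i * a) (3 * z * a)))))))
    distribute : ∀ w a X z → w + a * (X + 3 * z) ≡ w + a * X + 3 * z * a
    distribute = solve-∀
    right→E : ∀ i X → a + d + i ≡ X + 3 * z → suc n ≡ 3 * (z * z) + a * X → suc n + 3 * z * a ≡ 3 * (z * z)
      + a * (a + d + i)
    right→E i X c eq = trans (cong (_+ 3 * z * a) eq)
      (trans (sym (distribute (3 * (z * z)) a X z)) (cong (λ x → 3 * (z * z) + a * x) (sym c)))
    E→right : ∀ i X → a + d + i ≡ X + 3 * z → suc n + 3 * z * a ≡ 3 * (z * z) + a * (a + d + i) → suc n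
      ≡ 3 * (z * z) + a * X
    E→right i X c eq = ℕ.+-cancelʳ-≡ (3 * z * a) _ _
      (trans eq (trans (cong (λ x → 3 * (z * z) + a * x) c) (distribute (3 * (z * z)) a X z)))
    regroup : ∀ n a x Y → n + (x + Y) * a ≡ (n + a * Y) + a * x
    regroup = solve-∀
    below→E : ∀ i Y → 3 * z ≡ a + d + i + Y → suc n + a * Y ≡ 3 * (z * z) → suc n + 3 * z * a ≡ 3 * (z * z)
      + a * (a + d + i)
    below→E i Y c eq = trans (cong (λ x → suc n + x * a) c)
      (trans (regroup (suc n) a (a + d + i) Y) (cong (_+ a * (a + d + i)) eq))
    E→below : ∀ i Y → 3 * z ≡ a + d + i + Y → suc n + 3 * z * a ≡ 3 * (z * z) + a * (a + d + i) → suc n + a * Y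
      ≡ 3 * (z * z)
    E→below i Y c eq = ℕ.+-cancelʳ-≡ (a * (a + d + i)) _ _
      (trans (sym (regroup (suc n) a (a + d + i) Y)) (trans (sym (cong (λ x → suc n + x * a) c)) eq))
    swap : ∀ a d i Y → a + d + i + Y ≡ a + d + Y + i
    swap = solve-∀
    3z≤K : ∀ i → n ≡ leading e d s + i * a → 3 * z ≤ K
    3z≤K i eq = ℕ.*-monoʳ-≤ 3 (ℕ.≤-trans z≤
      (s≤s (ℕ.+-mono-≤ (ℕ.≤-trans (e≤leading e d s) (leading≤n e d s i eq))
      (ℕ.≤-trans (s≤leading e d s) (leading≤n e d s i eq)))))
    go : Dec (∃ λ i → n ≡ leading e d s + i * a) → positive a d z ≡ progression e d s n
    go (no ¬p) = trans (cong₂ _xor_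
      (⨁-zero (suc K) λ X _ → dec-false (Right? a d z X) λ (eq , le) →
        ¬p (X + 3 * z ∸ (a + d) , fromE _ (right→E _ X (ℕ.m+[n∸m]≡n le) eq)))
      (⨁-zero K λ Y _ → dec-false (Below? a d z (suc Y)) λ (eq , le) →
        ¬p (3 * z ∸ (a + d + suc Y) , fromE _
          (below→E _ (suc Y) (sym (trans (swap a d (3 * z ∸ (a + d + suc Y)) (suc Y)) (ℕ.m+[n∸m]≡n le))) eq))))
      (sym (dec-false (Progression? e d s) ¬p))
    go (yes p@(i , eq)) with ℕ.≤-total (3 * z) (a + d + i)
    ... | inj₁ le = trans (cong₂ _xor_
      (trans (⨁-single X (s≤s (X≤K z e X on))
        (λ X′ ≢ → dec-false (Right? a d z X′) λ (eq′ , _) → ≢ (X-unique z e X′ X eq′ on)))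
             (dec-true (Right? a d z X) (on , subst (a + d ≤_) c (ℕ.m≤m+n (a + d) i))))
      (⨁-zero K λ Y _ → dec-false (Below? a d z (suc Y)) λ (eq′ , _) → above-below z e X Y on eq′))
      (sym (dec-true (Progression? e d s) p))
      where
      X = a + d + i ∸ 3 * z
      c : a + d + i ≡ X + 3 * z
      c = sym (ℕ.m∸n+n≡m le)
      on : suc n ≡ 3 * (z * z) + a * X
      on = E→right i X c (toE i eq)
    ... | inj₂ le with 3 * z ∸ (a + d + i) in diff
    ...   | zero = trans (cong₂ _xor_
      (trans (⨁-single {n = suc K} 0 (s≤s z≤n)
        (λ X′ ≢ → dec-false (Right? a d z X′) λ (eq′ , _) → ≢ (X-unique z e X′ 0 eq′ on)))
             (dec-true (Right? a d z 0) (on , subst (a + d ≤_) c (ℕ.m≤m+n (a + d) i))))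
      (⨁-zero K λ Y _ → dec-false (Below? a d z (suc Y)) λ (eq′ , _) → above-below z e 0 Y on eq′))
      (sym (dec-true (Progression? e d s) p))
      where
      c : a + d + i ≡ 0 + 3 * z
      c = trans (sym (ℕ.+-identityʳ (a + d + i))) (trans (cong (a + d + i +_) (sym diff)) (ℕ.m+[n∸m]≡n le))
      on : suc n ≡ 3 * (z * z) + a * 0
      on = E→right i 0 c (toE i eq)
    ...   | suc Y = trans (cong₂ _xor_
      (⨁-zero (suc K) λ X _ → dec-false (Right? a d z X) λ (eq′ , _) → above-below z e X Y eq′ on)
      (trans (⨁-single Y (ℕ.≤-trans (ℕ.m+n≤o⇒n≤o (a + d + i) (ℕ.≤-reflexive (sym c))) (3z≤K i eq))
               (λ Y′ ≢ → dec-false (Below? a d z (suc Y′)) λ (eq′ , _) → ≢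
                 (ℕ.suc-injective (ℕ.*-cancelˡ-≡ (suc Y′) (suc Y) a
                 (ℕ.+-cancelˡ-≡ (suc n) _ _ (trans eq′ (sym on)))))))
             (dec-true (Below? a d z (suc Y))
               (on , subst (a + d + suc Y ≤_) (trans (swap a d (suc Y) i) (sym c)) (ℕ.m≤m+n (a + d + suc Y) i)))))
      (sym (dec-true (Progression? e d s) p))
      where
      c : 3 * z ≡ a + d + i + suc Y
      c = trans (sym (ℕ.m+[n∸m]≡n le)) (cong (a + d + i +_) diff)
      on : suc n + a * suc Y ≡ 3 * (z * z)
      on = E→below i (suc Y) c (toE i eq)

  -- The value s = e + z is the one for which the signed solution e - s is -z.
  negative-progression : ∀ e d z → negative (suc (2 * e)) d z ≡ progression e d (e + z) n
  negative-progression e d z = go (Progression? e d (e + z))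
    where
    a = suc (2 * e)
    J : ∀ i → suc (leading e d (e + z) + i * a) ≡ 3 * (z * z) + a * (a + d + 3 * z + i)
    J i = trans (cong (λ x → suc (x + i * a)) (leading-≡ e d (e + z))) (lem e d z i)
      where
      lem : ∀ e d z i → suc (suc (2 * e) * d + e * suc e + 3 * ((e + z) * suc (e + z)) + i * suc (2 * e))
        ≡ 3 * (z * z) + suc (2 * e) * (suc (2 * e) + d + 3 * z + i)
      lem = solve-∀
    go : Dec (∃ λ i → n ≡ leading e d (e + z) + i * a) → negative a d z ≡ progression e d (e + z) n
    go (no ¬p) = trans
      (⨁-zero (suc K) λ X _ → dec-false (Left? a d z X) λ (eq , le) →
        ¬p (X ∸ (a + d + 3 * z) , ℕ.suc-injective
          (trans eq (trans (cong (λ x → 3 * (z * z) + a * x) (sym (ℕ.m+[n∸m]≡n le))) (sym (J _))))))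
      (sym (dec-false (Progression? e d (e + z)) ¬p))
    go (yes p@(i , eq)) = trans
      (trans (⨁-single X (s≤s (X≤K z e X on))
        (λ X′ ≢ → dec-false (Left? a d z X′) λ (eq′ , _) → ≢ (X-unique z e X′ X eq′ on)))
             (dec-true (Left? a d z X) (on , ℕ.m≤m+n (a + d + 3 * z) i)))
      (sym (dec-true (Progression? e d (e + z)) p))
      where
      X = a + d + 3 * z + i
      on : suc n ≡ 3 * (z * z) + a * X
      on = trans (cong suc eq) (J i)

  positive-far : ∀ e d s → positive (suc (2 * e)) d (suc (e + s)) ≡ progression e d s n
  positive-far e d s = positive-progression e d s (suc (e + s)) ℕ.≤-refl
    (trans (cong (λ x → suc x + 3 * suc (e + s) * suc (2 * e)) (leading-≡ e d s)) (lem e d s))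
    where
    lem : ∀ e d s → suc (suc (2 * e) * d + e * suc e + 3 * (s * suc s)) + 3 * suc (e + s) * suc (2 * e)
      ≡ 3 * (suc (e + s) * suc (e + s)) + suc (2 * e) * (suc (2 * e) + d)
    lem = solve-∀

  positive-near : ∀ {e} d s z → z + s ≡ e → positive (suc (2 * e)) d z ≡ progression e d s n
  positive-near d s z refl = positive-progression (z + s) d s z
    (ℕ.≤-trans (ℕ.m≤m+n z s) (ℕ.≤-trans (ℕ.m≤m+n (z + s) s) (ℕ.n≤1+n _)))
    (trans (cong (λ x → suc x + 3 * z * suc (2 * (z + s))) (leading-≡ (z + s) d s)) (lem d s z))
    where
    lem : ∀ d s z → suc (suc (2 * (z + s)) * d + (z + s) * suc (z + s) + 3 * (s * suc s))
      + 3 * z * suc (2 * (z + s)) ≡ 3 * (z * z) + suc (2 * (z + s)) * (suc (2 * (z + s)) + d)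
    lem = solve-∀

  -- Here k stands for z = 2k + 1, b is the number of odd z ≤ e, and f and g carry the two parities
  -- of s. The sequence f is assembled from z = e - s > 0, which runs backwards through k < b, and
  -- from the negative values e - s; g comes from z = e + s + 1.
  reindex : ∀ {N R} b {f g P Q : ℕ → Bool} → n ≤ N → b + suc n ≤ R →
    (∀ t → n < t → f t ≡ false) → (∀ t → n < t → g t ≡ false) →
    (∀ k k′ → suc (k + k′) ≡ b → P k ≡ f k′) → (∀ j → P (b + j) ≡ g j) → (∀ k → Q k ≡ f (b + k)) →
    ⨁ R (λ k → P k xor Q k) ≡ ⨁ (suc N) g xor ⨁ (suc N) f
  reindex {N} {R} b {f} {g} {P} {Q} n≤N b≤R f-large g-large near far neg = begin
    ⨁ R (λ k → P k xor Q k)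
      ≡⟨ ⨁-xor R P Q ⟩
    ⨁ R P xor ⨁ R Q
      ≡⟨ cong₂ _xor_ (cong (λ r → ⨁ r P) (sym b+R′)) (⨁-cong R λ k _ → neg k) ⟩
    ⨁ (b + R′) P xor ⨁ R (λ k → f (b + k))
      ≡⟨ cong (_xor ⨁ R (λ k → f (b + k)))
        (trans (⨁-+ b R′ P) (trans (cong₂ _xor_ (⨁-reverse b near) (⨁-cong R′ λ j _ → far j))
        (xor-comm (⨁ b f) (⨁ R′ g)))) ⟩
    (⨁ R′ g xor ⨁ b f) xor ⨁ R (λ k → f (b + k))
      ≡⟨ trans (xor-assoc (⨁ R′ g) (⨁ b f) _) (cong (⨁ R′ g xor_) (sym (⨁-+ b R f))) ⟩
    ⨁ R′ g xor ⨁ (b + R) f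
      ≡⟨ cong₂ _xor_ (trans (⨁-extend g-large n<R′) (sym (⨁-extend g-large (s≤s n≤N))))
                     (trans (⨁-extend f-large (ℕ.≤-trans (ℕ.m+n≤o⇒n≤o b b≤R) (ℕ.m≤n+m R b)))
                       (sym (⨁-extend f-large (s≤s n≤N)))) ⟩
    ⨁ (suc N) g xor ⨁ (suc N) f ∎
    where
    open ≡.≡-Reasoning
    R′ = R ∸ b
    b+R′ : b + R′ ≡ R
    b+R′ = ℕ.m+[n∸m]≡n (ℕ.m+n≤o⇒m≤o b b≤R)
    n<R′ : suc n ≤ R′
    n<R′ = ℕ.+-cancelˡ-≤ b _ _ (ℕ.≤-trans b≤R (ℕ.≤-reflexive (sym b+R′)))

  m<m+m : ∀ {m t} → m < t → m < t + t
  m<m+m {t = t} m<t = ℕ.≤-trans m<t (ℕ.m≤m+n t t)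

  -- The numbers e + s + 1 and e - s add up to the odd number 2e + 1, so every s is met at exactly
  -- one odd signed z; which of the two it is depends on the parities of e and s.
  signed-sum : ∀ e d {N R} → n ≤ N → suc n + suc n ≤ R →
    ⨁ R (λ k → positive (suc (2 * e)) d (odd-number k) xor negative (suc (2 * e)) d (odd-number k))
      ≡ ⨁ (suc N) (λ s → progression e d s n)
  signed-sum e d {N} {R} n≤N R≥ with ℕ.≤-<-connex e n
  ... | inj₂ n<e = trans
    (⨁-zero R λ k _ → cong₂ _xor_ (pos k)
      (trans (negative-progression e d (odd-number k)) (progression-large-e e d (e + odd-number k) n<e)))
    (sym (⨁-zero (suc N) λ s _ → progression-large-e e d s n<e))
    where
    pos : ∀ k → positive (suc (2 * e)) d (odd-number k) ≡ false
    pos k with ℕ.≤-<-connex (odd-number k) e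
    ... | inj₁ le = trans (positive-near d (e ∸ odd-number k) (odd-number k) (ℕ.m+[n∸m]≡n le))
      (progression-large-e e d (e ∸ odd-number k) n<e)
    ... | inj₂ lt = trans (cong (positive (suc (2 * e)) d) (sym (ℕ.m+[n∸m]≡n lt)))
      (trans (positive-far e d (odd-number k ∸ suc e)) (progression-large-e e d (odd-number k ∸ suc e) n<e))
  ... | inj₁ e≤n = trans (halves (parity e)) (trans (sym (⨁-even-odd (suc N) F))
    (⨁-extend (λ s N<s → progression-large-s e d s (ℕ.≤-<-trans n≤N N<s)) (ℕ.m≤m+n (suc N) (suc N))))
    where
    F : ℕ → Bool
    F s = progression e d s n
    evens odds : ℕ → Bool
    evens t = F (t + t)
    odds  t = F (suc (t + t))
    evens-large : ∀ t → n < t → evens t ≡ false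
    evens-large t n<t = progression-large-s e d _ (m<m+m n<t)
    odds-large : ∀ t → n < t → odds t ≡ false
    odds-large t n<t = progression-large-s e d _ (ℕ.m<n⇒m<1+n (m<m+m n<t))
    P Q : ℕ → Bool
    P k = positive (suc (2 * e)) d (odd-number k)
    Q k = negative (suc (2 * e)) d (odd-number k)
    halves : Parity e → ⨁ R (λ k → P k xor Q k) ≡ ⨁ (suc N) evens xor ⨁ (suc N) odds
    halves (even b b+b≡e) = reindex {R = R} b n≤N
      (ℕ.≤-trans (ℕ.+-monoˡ-≤ (suc n)
      (ℕ.≤-trans (ℕ.m≤m+n b b) (ℕ.≤-trans (ℕ.≤-reflexive b+b≡e) (ℕ.≤-trans e≤n (ℕ.n≤1+n n))))) R≥)
      odds-large evens-large
      (λ k k′ eq → positive-near d (suc (k′ + k′)) (odd-number k) (trans (lem₁ k k′) (trans (cong₂ _+_ eq eq) b+b≡e)))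
      (λ j → trans (cong (positive (suc (2 * e)) d) (trans (lem₂ b j) (cong (λ x → suc (x + (j + j))) b+b≡e)))
        (positive-far e d (j + j)))
      (λ k → trans (negative-progression e d (odd-number k))
        (cong F (trans (cong (_+ odd-number k) (sym b+b≡e)) (lem₃ b k))))
      where
      lem₁ : ∀ k k′ → suc (k + k) + suc (k′ + k′) ≡ suc (k + k′) + suc (k + k′)
      lem₁ = solve-∀
      lem₂ : ∀ b j → suc ((b + j) + (b + j)) ≡ suc (b + b + (j + j))
      lem₂ = solve-∀
      lem₃ : ∀ b k → b + b + suc (k + k) ≡ suc ((b + k) + (b + k))
      lem₃ = solve-∀
    halves (odd c c+c≡e) = trans (reindex {R = R} (suc c) n≤N
      (ℕ.≤-trans (ℕ.+-monoˡ-≤ (suc n)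
      (s≤s (ℕ.≤-trans (ℕ.m≤m+n c c) (ℕ.≤-trans (ℕ.n≤1+n _) (ℕ.≤-trans (ℕ.≤-reflexive c+c≡e) e≤n))))) R≥)
      evens-large odds-large
      (λ k k′ eq → positive-near d (k′ + k′) (odd-number k)
        (trans (lem₁ k k′) (trans (cong (λ x → suc (x + x)) (ℕ.suc-injective eq)) c+c≡e)))
      (λ j → trans (cong (positive (suc (2 * e)) d)
        (trans (lem₂ c j) (cong (λ x → suc (x + suc (j + j))) c+c≡e))) (positive-far e d (suc (j + j))))
      (λ k → trans (negative-progression e d (odd-number k))
        (cong F (trans (cong (_+ odd-number k) (sym c+c≡e)) (lem₃ c k)))))
      (xor-comm (⨁ (suc N) odds) (⨁ (suc N) evens))
      where
      lem₁ : ∀ k k′ → suc (k + k) + (k′ + k′) ≡ suc (k + k′ + (k + k′))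
      lem₁ = solve-∀
      lem₂ : ∀ c j → suc ((suc c + j) + (suc c + j)) ≡ suc (suc (c + c) + suc (j + j))
      lem₂ = solve-∀
      lem₃ : ∀ c k → suc (c + c) + suc (k + k) ≡ (suc c + k) + (suc c + k)
      lem₃ = solve-∀

%-≡⇒multiple : ∀ {a b} m .{{_ : NonZero m}} → a % m ≡ b % m → b ≤ a → ∃ λ q → a ≡ b + q * m
%-≡⇒multiple {a} {b} m eq b≤a = a / m ∸ b / m , (begin
  a                                              ≡⟨ m≡m%n+[m/n]*n a m ⟩
  a % m + a / m * m                              ≡⟨ cong₂ (λ x y → x + y * m) eq
    (sym (ℕ.m+[n∸m]≡n (/-monoˡ-≤ m b≤a))) ⟩
  b % m + (b / m + (a / m ∸ b / m)) * m          ≡⟨ cong (b % m +_) (ℕ.*-distribʳ-+ m (b / m) _) ⟩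
  b % m + (b / m * m + (a / m ∸ b / m) * m)      ≡⟨ ℕ.+-assoc (b % m) _ _ ⟨
  b % m + b / m * m + (a / m ∸ b / m) * m        ≡⟨ cong (_+ (a / m ∸ b / m) * m) (m≡m%n+[m/n]*n b m) ⟨
  b + (a / m ∸ b / m) * m                        ∎)
  where open ≡.≡-Reasoning

-- The points with a ≡ c (mod 6) to the right, and those with a ≡ -c (mod 6) below, are the points with
-- the same signed a ≡ c (mod 6) and the same X.
module FixedX (n c c̄ d d̄ : ℕ) (c+c̄ : c + c̄ ≡ 6) (d+d̄ : d + d̄ ≡ 1) (1≤c : 1 ≤ c) (1≤c̄ : 1 ≤ c̄) (X′ : ℕ) where

  open Points n

  X L : ℕ
  X = suc X′
  L = suc n

  column : ℕ → ℕ → Bool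
  column z r = (does (Right? (6 * r + c) d z X) xor does (Left? (6 * r + c) d z X)) xor does
    (Below? (6 * r + c̄) d̄ z X)

  -- The condition that L = 3z² + aX for some signed a ≡ c (mod 6), written as a congruence so that
  -- the sign of a does not appear.
  OnLine? : ∀ z → Dec (L % (6 * X) ≡ (c * X + 3 * (z * z)) % (6 * X))
  OnLine? z = L % (6 * X) ≟ (c * X + 3 * (z * z)) % (6 * X)

  -- The inequality a + d ≤ X + 3z times X, with aX replaced by L - 3z²; `Left′?` is the same for
  -- -z.
  Right′? : ∀ z → Dec (L + d * X ≤ X * X + 3 * z * X + 3 * (z * z))
  Right′? z = L + d * X ≤? X * X + 3 * z * X + 3 * (z * z)

  Left′? : ∀ z → Dec (L + d * X + 3 * z * X ≤ X * X + 3 * (z * z))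
  Left′? z = L + d * X + 3 * z * X ≤? X * X + 3 * (z * z)

  line : ℕ → Bool
  line z = does (OnLine? z) ∧ (does (Right′? z) xor does (Left′? z))

  above⇒on : ∀ z r → L ≡ 3 * (z * z) + (6 * r + c) * X → L % (6 * X) ≡ (c * X + 3 * (z * z)) % (6 * X)
  above⇒on z r eq = trans (cong (_% (6 * X)) (trans eq (lem (3 * (z * z)) r c X)))
    ([m+kn]%n≡m%n (c * X + 3 * (z * z)) r (6 * X))
    where
    lem : ∀ w r c X → w + (6 * r + c) * X ≡ c * X + w + r * (6 * X)
    lem = solve-∀

  below⇒on : ∀ z r → L + (6 * r + c̄) * X ≡ 3 * (z * z) → L % (6 * X) ≡ (c * X + 3 * (z * z)) % (6 * X)
  below⇒on z r eq = sym (trans (cong (_% (6 * X))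
    (trans (cong (c * X +_) (sym eq)) (trans (lem L r c c̄ X) (cong (λ x → L + (6 * r + x) * X) c+c̄))))
    (trans (cong (_% (6 * X)) (lem′ L r X)) ([m+kn]%n≡m%n L (suc r) (6 * X))))
    where
    lem : ∀ L r c c̄ X → c * X + (L + (6 * r + c̄) * X) ≡ L + (6 * r + (c + c̄)) * X
    lem = solve-∀
    lem′ : ∀ L r X → L + (6 * r + 6) * X ≡ L + suc r * (6 * X)
    lem′ = solve-∀

  on⇒point : ∀ z → L % (6 * X) ≡ (c * X + 3 * (z * z)) % (6 * X) →
    (∃ λ r → L ≡ 3 * (z * z) + (6 * r + c) * X) ⊎ (∃ λ r → L + (6 * r + c̄) * X ≡ 3 * (z * z))
  on⇒point z eq with ℕ.≤-total (c * X + 3 * (z * z)) L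
  ... | inj₁ le = let (q , eq′) = %-≡⇒multiple (6 * X) eq le in inj₁ (q , trans eq′ (lem (3 * (z * z)) q c X))
    where
    lem : ∀ w r c X → c * X + w + r * (6 * X) ≡ w + (6 * r + c) * X
    lem = solve-∀
  ... | inj₂ le with %-≡⇒multiple (6 * X) (sym eq) le
  ...   | zero , eq′ = inj₁ (0 , trans (sym (ℕ.+-identityʳ L)) (trans (sym eq′) (ℕ.+-comm (c * X) _)))
  ...   | suc q , eq′ = inj₂ (q , ℕ.+-cancelˡ-≡ (c * X) _ _
    (trans (lem L q c c̄ X) (trans (cong (λ x → L + (6 * q + x) * X) c+c̄) (trans (lem′ L q X) (sym eq′)))))
    where
    lem : ∀ L r c c̄ X → c * X + (L + (6 * r + c̄) * X) ≡ L + (6 * r + (c + c̄)) * X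
    lem = solve-∀
    lem′ : ∀ L r X → L + (6 * r + 6) * X ≡ L + suc r * (6 * X)
    lem′ = solve-∀

  positive-multiple : ∀ r {c} → 1 ≤ c → 1 ≤ (6 * r + c) * X
  positive-multiple r {c} 1≤c = ℕ.*-mono-≤ {1} {6 * r + c} {1} {X} (ℕ.≤-trans 1≤c (ℕ.m≤n+m c (6 * r))) (s≤s z≤n)

  not-both : ∀ z r r′ → L ≡ 3 * (z * z) + (6 * r + c) * X → L + (6 * r′ + c̄) * X ≢ 3 * (z * z)
  not-both z r r′ p q = ℕ.<⇒≱ (ℕ.≤-trans (ℕ.≤-reflexive (ℕ.+-comm 1 _))
    (ℕ.+-monoʳ-≤ (3 * (z * z)) (positive-multiple r 1≤c)))
    (ℕ.≤-trans (ℕ.≤-reflexive (sym p)) (ℕ.≤-trans (ℕ.m≤m+n L _) (ℕ.≤-reflexive q)))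

  coefficient-injective : ∀ c {r r′} → (6 * r + c) * X ≡ (6 * r′ + c) * X → r ≡ r′
  coefficient-injective c {r} {r′} eq = ℕ.*-cancelˡ-≡ r r′ 6
    (ℕ.+-cancelʳ-≡ c _ _ (ℕ.*-cancelʳ-≡ (6 * r + c) (6 * r′ + c) X eq))

  xor-falses : ∀ {a b c} → a ≡ false → b ≡ false → c ≡ false → (a xor b) xor c ≡ false
  xor-falses refl refl refl = refl

  column-off : ∀ z r → L ≢ 3 * (z * z) + (6 * r + c) * X → L + (6 * r + c̄) * X ≢ 3 * (z * z) → column z r ≡ false
  column-off z r p q = xor-falses (dec-false (Right? (6 * r + c) d z X) (p ∘ proj₁))
    (dec-false (Left? (6 * r + c) d z X) (p ∘ proj₁)) (dec-false (Below? (6 * r + c̄) d̄ z X) (q ∘ proj₁))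

  *X-⇔ : ∀ {a b u v w} → u ≡ w + a * X → v ≡ w + b * X → u ≤ v ⇔ a ≤ b
  *X-⇔ {a} {b} {w = w} refl refl = mk⇔ (λ le → ℕ.*-cancelʳ-≤ a b X (ℕ.+-cancelˡ-≤ w _ _ le))
    (λ le → ℕ.+-monoʳ-≤ w (ℕ.*-monoˡ-≤ X le))

  column-above : ∀ z r → L ≡ 3 * (z * z) + (6 * r + c) * X → column z r ≡ does (Right′? z) xor does (Left′? z)
  column-above z r eq = trans (cong₂ _xor_ (cong₂ _xor_
      (trans (cong (_∧ does (6 * r + c + d ≤? X + 3 * z)) (dec-true (suc n ≟ 3 * (z * z) + (6 * r + c) * X) eq))
             (sym (does-⇔ (*X-⇔ {w = w} (trans (cong (_+ d * X) eq) (lem₁ w a d X)) (lem₂ w z X)) (Right′? z)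
               (a + d ≤? X + 3 * z))))
      (trans (cong (_∧ does (6 * r + c + d + 3 * z ≤? X)) (dec-true (suc n ≟ 3 * (z * z) + (6 * r + c) * X) eq))
             (sym (does-⇔ (*X-⇔ {w = w} (trans (cong (λ x → x + d * X + 3 * z * X) eq) (lem₃ w a d z X))
               (ℕ.+-comm (X * X) w)) (Left′? z) (a + d + 3 * z ≤? X)))))
      (dec-false (Below? (6 * r + c̄) d̄ z X) (not-both z r r eq ∘ proj₁)))
    (xor-identityʳ _)
    where
    a = 6 * r + c
    w = 3 * (z * z)
    lem₁ : ∀ w a d X → w + a * X + d * X ≡ w + (a + d) * X
    lem₁ = solve-∀
    lem₂ : ∀ w z X → X * X + 3 * z * X + w ≡ w + (X + 3 * z) * X
    lem₂ = solve-∀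
    lem₃ : ∀ w a d z X → w + a * X + d * X + 3 * z * X ≡ w + (a + d + 3 * z) * X
    lem₃ = solve-∀

  d≤1 : d ≤ 1
  d≤1 = ℕ.m+n≤o⇒m≤o d (ℕ.≤-reflexive d+d̄)

  column-below : ∀ z r → L + (6 * r + c̄) * X ≡ 3 * (z * z) → column z r ≡ does (6 * r + c̄ + d̄ + X ≤? 3 * z)
  column-below z r eq = cong₂ _xor_
    (cong₂ _xor_ (dec-false (Right? (6 * r + c) d z X) (λ (p , _) → not-both z r r p eq))
      (dec-false (Left? (6 * r + c) d z X) (λ (p , _) → not-both z r r p eq)))
    (cong (_∧ does (6 * r + c̄ + d̄ + X ≤? 3 * z)) (dec-true (suc n + (6 * r + c̄) * X ≟ 3 * (z * z)) eq))

  complementary : ∀ {P Q : Set} (P? : Dec P) (Q? : Dec Q) → (P → ¬ Q) → (¬ P → Q) → true xor does P? ≡ does Q?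
  complementary (yes p) Q? f g = sym (dec-false Q? (f p))
  complementary (no ¬p) Q? f g = sym (dec-true Q? (g ¬p))

  -- For the signed coefficient -a the condition `Right′?` always holds, while the negation of
  -- `Left′?` is a + X + 1 ≤ d + 3z. By d + d̄ = 1 this is a + d̄ + X ≤ 3z, the condition in
  -- `Below?` for the opposite class.
  line-below : ∀ z r → L + (6 * r + c̄) * X ≡ 3 * (z * z) → does (Right′? z) xor does (Left′? z)
    ≡ does (6 * r + c̄ + d̄ + X ≤? 3 * z)
  line-below z r eq = trans (cong (_xor does (Left′? z)) (dec-true (Right′? z) right))
    (complementary (Left′? z) (a + d̄ + X ≤? 3 * z)
      (λ left le → ℕ.1+n≰n (ℕ.≤-trans (ℕ.≤-reflexive (trans (cong (_+ (a + X)) (sym d+d̄)) (lem₁ d d̄ a X)))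
        (ℕ.≤-trans (ℕ.+-monoʳ-≤ d le) (Equivalence.to bound left))))
      (λ ¬left → ℕ.+-cancelˡ-≤ d _ _
        (ℕ.≤-trans (ℕ.≤-reflexive (trans (sym (lem₁ d d̄ a X)) (cong (_+ (a + X)) d+d̄)))
        (ℕ.≰⇒> (¬left ∘ Equivalence.from bound)))))
    where
    a = 6 * r + c̄
    right : L + d * X ≤ X * X + 3 * z * X + 3 * (z * z)
    right = ℕ.≤-trans (ℕ.+-monoʳ-≤ L (ℕ.*-monoˡ-≤ X (ℕ.≤-trans d≤1 (ℕ.≤-trans 1≤c̄ (ℕ.m≤n+m c̄ (6 * r))))))
      (ℕ.≤-trans (ℕ.≤-reflexive eq) (ℕ.m≤n+m (3 * (z * z)) (X * X + 3 * z * X)))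
    lem₁ : ∀ d d̄ a X → d + d̄ + (a + X) ≡ d + (a + d̄ + X)
    lem₁ = solve-∀
    lem₂ : ∀ L d z X → L + d * X + 3 * z * X ≡ L + (d + 3 * z) * X
    lem₂ = solve-∀
    lem₃ : ∀ L a X → X * X + (L + a * X) ≡ L + (a + X) * X
    lem₃ = solve-∀
    bound : L + d * X + 3 * z * X ≤ X * X + 3 * (z * z) ⇔ d + 3 * z ≤ a + X
    bound = *X-⇔ {w = L} (lem₂ L d z X) (trans (cong (X * X +_) (sym eq)) (lem₃ L a X))

  -- Given z and X the signed a is determined, so at most one r contributes.
  column-sum : ∀ {R} k → k < R → L < R → ⨁ R (column (odd-number k)) ≡ line (odd-number k)
  column-sum {R} k k<R L<R = go (OnLine? z)
    where
    z = odd-number k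
    go : Dec (L % (6 * X) ≡ (c * X + 3 * (z * z)) % (6 * X)) → ⨁ R (column z) ≡ line z
    go (no off) = trans (⨁-zero R λ r _ → column-off z r (off ∘ above⇒on z r) (off ∘ below⇒on z r))
      (sym (cong (_∧ (does (Right′? z) xor does (Left′? z))) (dec-false (OnLine? z) off)))
    go (yes on) = trans (point (on⇒point z on))
      (sym (cong (_∧ (does (Right′? z) xor does (Left′? z))) (dec-true (OnLine? z) on)))
      where
      point : (∃ λ r → L ≡ 3 * (z * z) + (6 * r + c) * X) ⊎ (∃ λ r → L + (6 * r + c̄) * X ≡ 3 * (z * z)) →
        ⨁ R (column z) ≡ does (Right′? z) xor does (Left′? z)
      point (inj₁ (r , eq)) = trans
        (⨁-single r (ℕ.≤-<-trans (ℕ.≤-trans r≤ (ℕ.≤-trans (ℕ.m≤n+m _ (3 * (z * z))) (ℕ.≤-reflexive (sym eq)))) L<R)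
          λ r′ ≢ → column-off z r′ (λ eq′ → ≢
            (coefficient-injective c (ℕ.+-cancelˡ-≡ (3 * (z * z)) _ _ (trans (sym eq′) eq)))) (not-both z r r′ eq))
        (column-above z r eq)
        where
        r≤ : r ≤ (6 * r + c) * X
        r≤ = ℕ.≤-trans (ℕ.≤-trans (ℕ.m≤n*m r 6) (ℕ.m≤m+n (6 * r) c)) (ℕ.m≤m*n (6 * r + c) X)
      point (inj₂ (r , eq)) = trans (single (r ℕ.<? R)) (sym (line-below z r eq))
        where
        others : ∀ r′ → r′ ≢ r → column z r′ ≡ false
        others r′ ≢ = column-off z r′ (λ eq′ → not-both z r′ r eq′ eq)
          (λ eq′ → ≢ (coefficient-injective c̄ (ℕ.+-cancelˡ-≡ L _ _ (trans eq′ (sym eq)))))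
        single : Dec (r < R) → ⨁ R (column z) ≡ does (6 * r + c̄ + d̄ + X ≤? 3 * z)
        single (yes r<R) = trans (⨁-single r r<R others) (column-below z r eq)
        -- A coefficient outside the range has 6r ≥ 6(k + 1) > 3z, so the inequality in `Below?`
        -- fails.
        single (no r≮R) = trans (⨁-zero R λ r′ r′<R → others r′ λ { refl → r≮R r′<R })
          (sym (dec-false (6 * r + c̄ + d̄ + X ≤? 3 * z) λ le → r≮R (ℕ.*-cancelˡ-< 6 r R (ℕ.≤-<-trans
            (ℕ.≤-trans (ℕ.m≤m+n (6 * r) c̄) (ℕ.≤-trans (ℕ.m≤m+n _ d̄) (ℕ.≤-trans (ℕ.m≤m+n _ X) le)))
            (ℕ.≤-trans (ℕ.≤-trans (ℕ.≤-trans (ℕ.≤-reflexive (ℕ.+-comm 1 (3 * z)))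
              (ℕ.+-monoʳ-≤ (3 * z) (s≤s z≤n))) (ℕ.≤-reflexive (lem k))) (ℕ.*-monoʳ-≤ 6 k<R))))))
          where
          lem : ∀ k → 3 * suc (k + k) + 3 ≡ 6 * suc k
          lem = solve-∀

  -- The reflection z ↦ X - z preserves Left′ and the translation z ↦ X + z turns Left′ into Right′.
  module Vanishing (x : ℕ) (X≡4x : X ≡ (x + x) + (x + x)) where

    H : ℕ
    H = x + x

    translate-z : ∀ k → odd-number (H + k) ≡ odd-number k + X
    translate-z k = trans (lem H k) (cong (odd-number k +_) (sym X≡4x))
      where
      lem : ∀ H k → suc ((H + k) + (H + k)) ≡ suc (k + k) + (H + H)
      lem = solve-∀

    reflect-z : ∀ k k′ → suc (k + k′) ≡ H → odd-number k + odd-number k′ ≡ X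
    reflect-z k k′ eq = trans (lem k k′) (trans (cong₂ _+_ eq eq) (sym X≡4x))
      where
      lem : ∀ k k′ → suc (k + k) + suc (k′ + k′) ≡ suc (k + k′) + suc (k + k′)
      lem = solve-∀

    -- The difference 3(z + X)² - 3z² = 6zX + 3X² is a multiple of 6X because X is even.
    line-residue-translate : ∀ z → (c * X + 3 * ((z + X) * (z + X))) % (6 * X) ≡ (c * X + 3 * (z * z)) % (6 * X)
    line-residue-translate z = trans (cong (_% (6 * X))
      (trans (cong (λ x → c * X + 3 * ((z + X) * (z + x))) X≡4x)
        (trans (cong (λ y → c * X + 3 * ((z + y) * (z + (H + H)))) X≡4x)
        (trans (lem (c * X) H z) (cong (λ y → c * X + 3 * (z * z) + (z + H) * (6 * y)) (sym X≡4x))))))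
      ([m+kn]%n≡m%n (c * X + 3 * (z * z)) (z + H) (6 * X))
      where
      lem : ∀ w H z → w + 3 * ((z + (H + H)) * (z + (H + H))) ≡ w + 3 * (z * z) + (z + H) * (6 * (H + H))
      lem = solve-∀

    line-residue-reflect : ∀ z z′ → z + z′ ≡ X → (c * X + 3 * (z * z)) % (6 * X) ≡ (c * X + 3 * (z′ * z′)) % (6 * X)
    line-residue-reflect z z′ eq = trans (sym ([m+kn]%n≡m%n (c * X + 3 * (z * z)) z′ (6 * X)))
      (trans (cong (_% (6 * X)) (trans (cong (λ y → c * X + 3 * (z * z) + z′ * (6 * y)) (sym eq))
        (trans (lem (c * X) z z′) (trans (cong (λ y → c * X + 3 * (z′ * z′) + 3 * ((z + z′) * y)) eq)
          (trans (cong (λ y → c * X + 3 * (z′ * z′) + 3 * (y * X)) (trans eq X≡4x))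
          (lem′ (c * X + 3 * (z′ * z′)) H X))))))
      ([m+kn]%n≡m%n (c * X + 3 * (z′ * z′)) H (6 * X)))
      where
      lem : ∀ w z z′ → w + 3 * (z * z) + z′ * (6 * (z + z′)) ≡ w + 3 * (z′ * z′) + 3 * ((z + z′) * (z + z′))
      lem = solve-∀
      lem′ : ∀ w H X → w + 3 * ((H + H) * X) ≡ w + H * (6 * X)
      lem′ = solve-∀

    on right left : ℕ → Bool
    on k = does (OnLine? (odd-number k))
    right k = does (Right′? (odd-number k))
    left k = does (Left′? (odd-number k))

    on-residue : ∀ z z′ → (c * X + 3 * (z * z)) % (6 * X) ≡ (c * X + 3 * (z′ * z′)) % (6 * X) → does (OnLine? z)
      ≡ does (OnLine? z′)
    on-residue z z′ eq = does-⇔ (mk⇔ (λ p → trans p eq) (λ p → trans p (sym eq))) (OnLine? z) (OnLine? z′)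

    on-translate : ∀ k → on (H + k) ≡ on k
    on-translate k = trans (cong (does ∘ OnLine?) (translate-z k))
      (on-residue (odd-number k + X) (odd-number k) (line-residue-translate (odd-number k)))

    on-reflect : ∀ k k′ → suc (k + k′) ≡ H → on k ≡ on k′
    on-reflect k k′ eq = on-residue (odd-number k) (odd-number k′)
      (line-residue-reflect (odd-number k) (odd-number k′) (reflect-z k k′ eq))

    cancel-⇔ : ∀ {u v u′ v′} w → u ≡ u′ + w → v ≡ v′ + w → u ≤ v ⇔ u′ ≤ v′
    cancel-⇔ w refl refl = mk⇔ (ℕ.+-cancelʳ-≤ w _ _) (ℕ.+-monoˡ-≤ w)

    left-translate : ∀ k → left (H + k) ≡ right k
    left-translate k = trans (cong (does ∘ Left′?) (translate-z k))
      (does-⇔ (cancel-⇔ (3 * z * X + 3 * X * X) (lem₁ (L + d * X) z X) (lem₂ z X)) (Left′? (z + X)) (Right′? z))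
      where
      z = odd-number k
      lem₁ : ∀ l z X → l + 3 * (z + X) * X ≡ l + (3 * z * X + 3 * X * X)
      lem₁ = solve-∀
      lem₂ : ∀ z X → X * X + 3 * ((z + X) * (z + X)) ≡ X * X + 3 * z * X + 3 * (z * z) + (3 * z * X + 3 * X * X)
      lem₂ = solve-∀

    -- When X = z + z′, substituting it in the quadratic terms leaves L + dX + zz′ ≤ z² + z′², which
    -- is symmetric in z and z′.
    left-reflect : ∀ k k′ → suc (k + k′) ≡ H → left k ≡ left k′
    left-reflect k k′ eq = trans (symmetric z z′ (reflect-z k k′ eq)) (trans
      (does-⇔ (mk⇔ (subst₂ _≤_ (cong (L + d * X +_) (ℕ.*-comm z z′)) (ℕ.+-comm (z * z) _))
        (subst₂ _≤_ (cong (L + d * X +_) (ℕ.*-comm z′ z)) (ℕ.+-comm (z′ * z′) _)))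
        (L + d * X + z * z′ ≤? z * z + z′ * z′) (L + d * X + z′ * z ≤? z′ * z′ + z * z))
      (sym (symmetric z′ z (trans (ℕ.+-comm z′ z) (reflect-z k k′ eq)))))
      where
      z = odd-number k
      z′ = odd-number k′
      lem₁ : ∀ l z z′ → l + 3 * z * (z + z′) ≡ l + z * z′ + (3 * (z * z) + 2 * (z * z′))
      lem₁ = solve-∀
      lem₂ : ∀ z z′ → (z + z′) * (z + z′) + 3 * (z * z) ≡ z * z + z′ * z′ + (3 * (z * z) + 2 * (z * z′))
      lem₂ = solve-∀
      symmetric : ∀ z z′ → z + z′ ≡ X → does (Left′? z) ≡ does (L + d * X + z * z′ ≤? z * z + z′ * z′)
      symmetric z z′ eq = does-⇔ (cancel-⇔ (3 * (z * z) + 2 * (z * z′))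
        (trans (cong (λ y → L + d * X + 3 * z * y) (sym eq)) (lem₁ (L + d * X) z z′))
        (trans (cong (λ y → y * y + 3 * (z * z)) (sym eq)) (lem₂ z z′)))
        (Left′? z) (L + d * X + z * z′ ≤? z * z + z′ * z′)

    right-large : ∀ k → L ≤ k → right k ≡ true
    right-large k L≤k = dec-true (Right′? z)
      (ℕ.≤-trans (ℕ.+-mono-≤ (ℕ.≤-trans L≤k (ℕ.≤-trans k≤z z≤zX)) (ℕ.*-monoˡ-≤ X {d} {z} (ℕ.≤-trans d≤1 (s≤s z≤n))))
      (ℕ.≤-trans (ℕ.≤-reflexive (ℕ.+-comm (z * X) (z * X)))
        (ℕ.≤-trans (ℕ.≤-trans (ℕ.m≤m+n (z * X + z * X) (z * X)) (ℕ.≤-reflexive (lem z X)))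
        (ℕ.≤-trans (ℕ.m≤n+m (3 * z * X) (X * X)) (ℕ.m≤m+n (X * X + 3 * z * X) (3 * (z * z)))))))
      where
      z = odd-number k
      k≤z : k ≤ z
      k≤z = ℕ.≤-trans (ℕ.m≤m+n k k) (ℕ.n≤1+n (k + k))
      z≤zX : z ≤ z * X
      z≤zX = ℕ.m≤m*n z X
      lem : ∀ z X → z * X + z * X + z * X ≡ 3 * z * X
      lem = solve-∀

    -- The left terms with z < X cancel by reflection, and the later ones are translates of right
    -- terms. This leaves the last `H` right terms; there `right` holds throughout, so they form a
    -- full period of `on` and cancel by reflection as well.
    line-sum : ∀ {R} → H + L ≤ R → ⨁ R (λ k → line (odd-number k)) ≡ false
    line-sum {R} H+L≤R = begin
      ⨁ R (λ k → on k ∧ (right k xor left k))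
        ≡⟨ trans (⨁-cong R λ k _ → ∧-distribˡ-xor (on k) (right k) (left k)) (⨁-xor R _ _) ⟩
      ⨁ R (λ k → on k ∧ right k) xor ⨁ R (λ k → on k ∧ left k)
        ≡⟨ cong₂ _xor_ rights lefts ⟩
      ⨁ R′ (λ k → on k ∧ right k) xor ⨁ R′ (λ k → on k ∧ right k)
        ≡⟨ xor-same (⨁ R′ (λ k → on k ∧ right k)) ⟩
      false ∎
      where
      open ≡.≡-Reasoning
      R′ = R ∸ H
      H+R′ : H + R′ ≡ R
      H+R′ = ℕ.m+[n∸m]≡n (ℕ.m+n≤o⇒m≤o H H+L≤R)
      L≤R′ : L ≤ R′
      L≤R′ = ℕ.+-cancelˡ-≤ H _ _ (ℕ.≤-trans H+L≤R (ℕ.≤-reflexive (sym H+R′)))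
      rights : ⨁ R (λ k → on k ∧ right k) ≡ ⨁ R′ (λ k → on k ∧ right k)
      rights = begin
        ⨁ R (λ k → on k ∧ right k)
          ≡⟨ trans (cong (λ m → ⨁ m (λ k → on k ∧ right k)) (trans (sym H+R′) (ℕ.+-comm H R′))) (⨁-+ R′ H _) ⟩
        ⨁ R′ (λ k → on k ∧ right k) xor ⨁ H (λ k → on (R′ + k) ∧ right (R′ + k))
          ≡⟨ cong (⨁ R′ (λ k → on k ∧ right k) xor_) (trans
               (⨁-cong H λ k _ → trans (cong (on (R′ + k) ∧_)
                 (right-large (R′ + k) (ℕ.≤-trans L≤R′ (ℕ.m≤m+n R′ k)))) (∧-identityʳ (on (R′ + k))))
               (trans (⨁-periodic H R′ on-translate) (⨁-reflect x on-reflect))) ⟩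
        ⨁ R′ (λ k → on k ∧ right k) xor false
          ≡⟨ xor-identityʳ _ ⟩
        ⨁ R′ (λ k → on k ∧ right k) ∎
      lefts : ⨁ R (λ k → on k ∧ left k) ≡ ⨁ R′ (λ k → on k ∧ right k)
      lefts = begin
        ⨁ R (λ k → on k ∧ left k)
          ≡⟨ trans (cong (λ m → ⨁ m (λ k → on k ∧ left k)) (sym H+R′)) (⨁-+ H R′ _) ⟩
        ⨁ H (λ k → on k ∧ left k) xor ⨁ R′ (λ k → on (H + k) ∧ left (H + k))
          ≡⟨ cong₂ _xor_ (⨁-reflect x λ k k′ eq → cong₂ _∧_ (on-reflect k k′ eq) (left-reflect k k′ eq))
                         (⨁-cong R′ λ k _ → cong₂ _∧_ (on-translate k) (left-translate k)) ⟩
        ⨁ R′ (λ k → on k ∧ right k) ∎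

-- Counting the points when n ≡ 2 (mod 4)

xor-exchange : ∀ a b c d → (a xor b) xor (c xor d) ≡ (a xor d) xor (c xor b)
xor-exchange a b c d = trans (cong ((a xor b) xor_) (xor-comm c d))
  (trans (xor-interchange a b d c) (cong ((a xor d) xor_) (xor-comm b c)))

module Count (n t : ℕ) (n≡ : n ≡ 2 + t * 4) where

  open Points n

  -- One bound for r and k: it leaves room for a half-translation H ≤ X ≤ `K` followed by n + 1 more
  -- terms, as in `line-sum`, and for the 2(n + 1) terms of `signed-sum`.
  R : ℕ
  R = K + (suc n + suc n)

  three-squares : ∀ k → 3 * (odd-number k * odd-number k) ≡ 3 + 24 * triangle k
  three-squares k = trans (lem k)
    (cong (3 +_) (trans (cong (12 *_) (sym (double-triangle k))) (sym (ℕ.*-assoc 12 2 (triangle k)))))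
    where
    lem : ∀ k → 3 * (suc (k + k) * suc (k + k)) ≡ 3 + 12 * (k * suc k)
    lem = solve-∀

  4∣24* : ∀ m → 4 ∣ 24 * m
  4∣24* m = ∣-trans (divides 6 refl) (m∣m*n m)

  -- The square of an odd number is 1 modulo 4, so multiplying once more by it recovers X.
  odd-cancel : ∀ m X → 4 ∣ suc (2 * m) * X → 4 ∣ X
  odd-cancel m X d = ∣m+n∣m⇒∣n (subst (4 ∣_) (lem m X) (∣n⇒∣m*n (suc (2 * m)) d)) (m∣m*n (m * suc m * X))
    where
    lem : ∀ m X → suc (2 * m) * (suc (2 * m) * X) ≡ 4 * (m * suc m * X) + X
    lem = solve-∀

  -- Here n + 1 = 3 + 4t and 3z² = 3 + 24 `triangle k`, so 4 divides aX, and a is odd.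
  right-4∣ : ∀ k m X → suc n ≡ 3 * (odd-number k * odd-number k) + suc (2 * m) * X → 4 ∣ X
  right-4∣ k m X eq = odd-cancel m X (∣m+n∣m⇒∣n (subst (4 ∣_) eq′ (n∣m*n t)) (4∣24* (triangle k)))
    where
    eq′ : t * 4 ≡ 24 * triangle k + suc (2 * m) * X
    eq′ = ℕ.+-cancelˡ-≡ 3 _ _ (trans (sym (cong suc n≡)) (trans eq (cong (_+ suc (2 * m) * X) (three-squares k))))

  below-4∣ : ∀ k m X → suc n + suc (2 * m) * X ≡ 3 * (odd-number k * odd-number k) → 4 ∣ X
  below-4∣ k m X eq = odd-cancel m X (∣m+n∣m⇒∣n (subst (4 ∣_) (sym eq′) (4∣24* (triangle k))) (n∣m*n t))
    where
    eq′ : t * 4 + suc (2 * m) * X ≡ 24 * triangle k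
    eq′ = ℕ.+-cancelˡ-≡ 3 _ _ (trans (cong (λ x → suc x + suc (2 * m) * X) (sym n≡)) (trans eq (three-squares k)))

  n<R : suc n < R
  n<R = ℕ.≤-trans (ℕ.m<m+n (suc n) (s≤s z≤n)) (ℕ.m≤n+m (suc n + suc n) K)

  fixedX-vanishes : ∀ c c̄ d d̄ (c+c̄ : c + c̄ ≡ 6) (d+d̄ : d + d̄ ≡ 1) (1≤c : 1 ≤ c) (1≤c̄ : 1 ≤ c̄) →
    (∃ λ m → c ≡ suc (2 * m)) → (∃ λ m → c̄ ≡ suc (2 * m)) → ∀ X′ → X′ < K →
    ⨁ R (λ k → ⨁ R (FixedX.column n c c̄ d d̄ c+c̄ d+d̄ 1≤c 1≤c̄ X′ (odd-number k))) ≡ false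
  fixedX-vanishes c c̄ d d̄ c+c̄ d+d̄ 1≤c 1≤c̄ (m , c≡) (m̄ , c̄≡) X′ X′<K with 4 ∣? suc X′
  ... | no 4∤X = ⨁-zero R λ k _ → ⨁-zero R λ r _ → column-off (odd-number k) r
      (λ eq → 4∤X (right-4∣ k (3 * r + m) X
        (trans eq (cong (λ a → 3 * (odd-number k * odd-number k) + a * X) (odd-coefficient r c≡)))))
      (λ eq → 4∤X (below-4∣ k (3 * r + m̄) X (trans (cong (λ a → suc n + a * X) (sym (odd-coefficient r c̄≡))) eq)))
    where
    open FixedX n c c̄ d d̄ c+c̄ d+d̄ 1≤c 1≤c̄ X′
    odd-coefficient : ∀ r {c m} → c ≡ suc (2 * m) → 6 * r + c ≡ suc (2 * (3 * r + m))
    odd-coefficient r {m = m} refl = lem r m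
      where
      lem : ∀ r m → 6 * r + suc (2 * m) ≡ suc (2 * (3 * r + m))
      lem = solve-∀
  ... | yes (divides x X≡) = trans (⨁-cong R λ k k<R → column-sum k k<R n<R) (line-sum
    (ℕ.+-mono-≤ (ℕ.≤-trans (ℕ.m≤m+n (x + x) (x + x)) (ℕ.≤-trans (ℕ.≤-reflexive (sym X≡4x)) X′<K))
      (ℕ.m≤m+n (suc n) (suc n))))
    where
    open FixedX n c c̄ d d̄ c+c̄ d+d̄ 1≤c 1≤c̄ X′
    X≡4x : X ≡ (x + x) + (x + x)
    X≡4x = trans X≡ (lem x)
      where
      lem : ∀ x → x * 4 ≡ (x + x) + (x + x)
      lem = solve-∀
    open Vanishing x X≡4x

  -- Each class takes the points below from the other one, together with the offset d of that other
  -- class; `cell` makes the trade by `xor-exchange`.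
  module A₁ = FixedX n 1 5 1 0 refl refl (s≤s z≤n) (s≤s z≤n)
  module A₅ = FixedX n 5 1 0 1 refl refl (s≤s z≤n) (s≤s z≤n)

  split : ∀ a d z → 1 ≤ a → positive a d z xor negative a d z ≡ does (Right? a d z 0) xor
    ⨁ K (λ X → (does (Right? a d z (suc X)) xor does (Left? a d z (suc X))) xor does (Below? a d z (suc X)))
  split a d z 1≤a = begin
    (⨁ (suc K) r xor ⨁ K b) xor ⨁ (suc K) l
      ≡⟨ cong₂ (λ x y → (x xor ⨁ K b) xor y) (⨁-suc K r) (trans (⨁-suc K l) (cong (_xor ⨁ K (l ∘ suc)) l0)) ⟩
    ((r 0 xor ⨁ K (r ∘ suc)) xor ⨁ K b) xor ⨁ K (l ∘ suc)
      ≡⟨ trans (xor-assoc (r 0 xor ⨁ K (r ∘ suc)) (⨁ K b) (⨁ K (l ∘ suc)))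
        (trans (xor-assoc (r 0) _ _) (cong (λ x → r 0 xor (⨁ K (r ∘ suc) xor x)) (xor-comm (⨁ K b) _))) ⟩
    r 0 xor (⨁ K (r ∘ suc) xor (⨁ K (l ∘ suc) xor ⨁ K b))
      ≡⟨ cong (r 0 xor_) (sym (xor-assoc (⨁ K (r ∘ suc)) _ _)) ⟩
    r 0 xor ((⨁ K (r ∘ suc) xor ⨁ K (l ∘ suc)) xor ⨁ K b)
      ≡⟨ cong (r 0 xor_) (trans (cong (_xor ⨁ K b) (sym (⨁-xor K (r ∘ suc) (l ∘ suc)))) (sym (⨁-xor K _ b))) ⟩
    r 0 xor ⨁ K (λ X → (r (suc X) xor l (suc X)) xor b X) ∎
    where
    open ≡.≡-Reasoning
    r l b : ℕ → Bool
    r X = does (Right? a d z X)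
    l X = does (Left? a d z X)
    b X = does (Below? a d z (suc X))
    l0 : l 0 ≡ false
    l0 = dec-false (Left? a d z 0) λ (_ , le) → ℕ.<⇒≱ 1≤a (ℕ.m+n≤o⇒m≤o a (ℕ.m+n≤o⇒m≤o (a + d) le))

  base : ℕ → ℕ → Bool
  base k r = does (suc n ≟ 3 * (odd-number k * odd-number k)) ∧ does (r ≟ k)

  -- At X = 0 the equation no longer contains a. The inequalities 6r + 2 ≤ 6k + 3 and 6r + 5 ≤ 6k +
  -- 3 mean r ≤ k and r < k, which differ only at r = k, so each z with 3z² = n + 1 is counted once.
  base-sum : ∀ r k → does (Right? (6 * r + 1) 1 (odd-number k) 0) xor does
    (Right? (6 * r + 5) 0 (odd-number k) 0) ≡ base k r
  base-sum r k = trans (cong₂ _xor_ (cong (_∧ does (6 * r + 1 + 1 ≤? 3 * odd-number k)) (eq (6 * r + 1)))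
    (cong (_∧ does (6 * r + 5 + 0 ≤? 3 * odd-number k)) (eq (6 * r + 5))))
    (trans (sym (∧-distribˡ-xor (does (suc n ≟ w)) _ _)) (cong (does (suc n ≟ w) ∧_) (trans
      (cong₂ _xor_ (does-⇔ (mk⇔ to₁ from₁) (6 * r + 1 + 1 ≤? 3 * odd-number k) (r ≤? k))
        (does-⇔ (mk⇔ to₅ from₅) (6 * r + 5 + 0 ≤? 3 * odd-number k) (r ℕ.<? k)))
      trichotomy)))
    where
    w = 3 * (odd-number k * odd-number k)
    eq : ∀ a → does (suc n ≟ w + a * 0) ≡ does (suc n ≟ w)
    eq a = cong (λ x → does (suc n ≟ x)) (trans (cong (w +_) (ℕ.*-zeroʳ a)) (ℕ.+-identityʳ w))
    3z : ∀ k → 3 * suc (k + k) ≡ 6 * k + 3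
    3z = solve-∀
    to₁ : 6 * r + 1 + 1 ≤ 3 * odd-number k → r ≤ k
    to₁ le = ℕ.≮⇒≥ λ k<r → contradiction (ℕ.+-cancelˡ-≤ (6 * k) 8 3 (ℕ.≤-trans (ℕ.≤-trans (ℕ.≤-reflexive (lem k))
      (ℕ.+-monoˡ-≤ 1 (ℕ.+-monoˡ-≤ 1 (ℕ.*-monoʳ-≤ 6 k<r)))) (ℕ.≤-trans le (ℕ.≤-reflexive (3z k))))) (from-no (8 ≤? 3))
      where
      lem : ∀ k → 6 * k + 8 ≡ 6 * suc k + 1 + 1
      lem = solve-∀
    from₁ : r ≤ k → 6 * r + 1 + 1 ≤ 3 * odd-number k
    from₁ le = ℕ.≤-trans (ℕ.≤-reflexive (ℕ.+-assoc (6 * r) 1 1))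
      (ℕ.≤-trans (ℕ.+-mono-≤ (ℕ.*-monoʳ-≤ 6 le) (s≤s (s≤s z≤n))) (ℕ.≤-reflexive (sym (3z k))))
    to₅ : 6 * r + 5 + 0 ≤ 3 * odd-number k → r < k
    to₅ le = ℕ.≰⇒> λ k≤r → contradiction (ℕ.+-cancelˡ-≤ (6 * k) 5 3 (ℕ.≤-trans (ℕ.+-monoˡ-≤ 5 (ℕ.*-monoʳ-≤ 6 k≤r))
      (ℕ.≤-trans (ℕ.m≤m+n (6 * r + 5) 0) (ℕ.≤-trans le (ℕ.≤-reflexive (3z k)))))) (from-no (5 ≤? 3))
    from₅ : r < k → 6 * r + 5 + 0 ≤ 3 * odd-number k
    from₅ lt = ℕ.≤-trans (ℕ.≤-trans
      (ℕ.+-monoˡ-≤ 0 (ℕ.+-monoʳ-≤ (6 * r) {5} {6} (s≤s (s≤s (s≤s (s≤s (s≤s z≤n)))))))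
      (ℕ.≤-trans (ℕ.≤-reflexive (lem r)) (ℕ.*-monoʳ-≤ 6 lt)))
      (ℕ.≤-trans (ℕ.m≤m+n (6 * k) 3) (ℕ.≤-reflexive (sym (3z k))))
      where
      lem : ∀ r → 6 * r + 6 + 0 ≡ 6 * suc r
      lem = solve-∀
    trichotomy : does (r ≤? k) xor does (r ℕ.<? k) ≡ does (r ≟ k)
    trichotomy with ℕ.<-cmp r k
    ... | tri< r<k r≢k _ = trans (cong₂ _xor_ (dec-true (r ≤? k) (ℕ.<⇒≤ r<k)) (dec-true (r ℕ.<? k) r<k))
      (sym (dec-false (r ≟ k) r≢k))
    ... | tri≈ r≮k r≡k _ = trans (cong₂ _xor_ (dec-true (r ≤? k) (ℕ.≤-reflexive r≡k))
      (dec-false (r ℕ.<? k) r≮k)) (sym (dec-true (r ≟ k) r≡k))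
    ... | tri> r≮k r≢k k<r = trans (cong₂ _xor_ (dec-false (r ≤? k) (ℕ.<⇒≱ k<r)) (dec-false (r ℕ.<? k) r≮k))
      (sym (dec-false (r ≟ k) r≢k))

  signed : ℕ → ℕ → ℕ → Bool
  signed a d k = positive a d (odd-number k) xor negative a d (odd-number k)

  cell : ∀ r k → signed (suc (2 * (3 * r))) 1 k xor signed (suc (2 * (2 + 3 * r))) 0 k
    ≡ base k r xor ⨁ K (λ X → A₁.column X (odd-number k) r xor A₅.column X (odd-number k) r)
  cell r k = begin
    signed (suc (2 * (3 * r))) 1 k xor signed (suc (2 * (2 + 3 * r))) 0 k
      ≡⟨ cong₂ (λ a b → signed a 1 k xor signed b 0 k) (lem₁ r) (lem₅ r) ⟩
    signed (6 * r + 1) 1 k xor signed (6 * r + 5) 0 k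
      ≡⟨ cong₂ _xor_ (split (6 * r + 1) 1 (odd-number k) (ℕ.m≤n+m 1 (6 * r)))
        (split (6 * r + 5) 0 (odd-number k) (ℕ.≤-trans (s≤s z≤n) (ℕ.m≤n+m 5 (6 * r)))) ⟩
    (does (Right? (6 * r + 1) 1 (odd-number k) 0) xor ⨁ K f₁)
      xor (does (Right? (6 * r + 5) 0 (odd-number k) 0) xor ⨁ K f₅)
      ≡⟨ xor-interchange (does (Right? (6 * r + 1) 1 (odd-number k) 0)) (⨁ K f₁) _ _ ⟩
    (does (Right? (6 * r + 1) 1 (odd-number k) 0) xor does (Right? (6 * r + 5) 0 (odd-number k) 0))
      xor (⨁ K f₁ xor ⨁ K f₅)
      ≡⟨ cong₂ _xor_ (base-sum r k) (trans (sym (⨁-xor K f₁ f₅)) (⨁-cong K λ X _ →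
           xor-exchange (g (6 * r + 1) 1 X) (does (Below? (6 * r + 1) 1 (odd-number k) (suc X)))
             (g (6 * r + 5) 0 X) _)) ⟩
    base k r xor ⨁ K (λ X → A₁.column X (odd-number k) r xor A₅.column X (odd-number k) r) ∎
    where
    open ≡.≡-Reasoning
    g : ℕ → ℕ → ℕ → Bool
    g a d X = does (Right? a d (odd-number k) (suc X)) xor does (Left? a d (odd-number k) (suc X))
    f₁ f₅ : ℕ → Bool
    f₁ X = g (6 * r + 1) 1 X xor does (Below? (6 * r + 1) 1 (odd-number k) (suc X))
    f₅ X = g (6 * r + 5) 0 X xor does (Below? (6 * r + 5) 0 (odd-number k) (suc X))
    lem₁ : ∀ r → suc (2 * (3 * r)) ≡ 6 * r + 1
    lem₁ = solve-∀
    lem₅ : ∀ r → suc (2 * (2 + 3 * r)) ≡ 6 * r + 5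
    lem₅ = solve-∀

  columns-vanish : ⨁ R (λ r → ⨁ R
    (λ k → ⨁ K (λ X → A₁.column X (odd-number k) r xor A₅.column X (odd-number k) r))) ≡ false
  columns-vanish = begin
    ⨁ R (λ r → ⨁ R (λ k → ⨁ K (λ X → f X k r)))
      ≡⟨ ⨁-swap R R (λ r k → ⨁ K (λ X → f X k r)) ⟩
    ⨁ R (λ k → ⨁ R (λ r → ⨁ K (λ X → f X k r)))
      ≡⟨ ⨁-cong R (λ k _ → ⨁-swap R K (λ r X → f X k r)) ⟩
    ⨁ R (λ k → ⨁ K (λ X → ⨁ R (f X k)))
      ≡⟨ ⨁-swap R K (λ k X → ⨁ R (f X k)) ⟩
    ⨁ K (λ X → ⨁ R (λ k → ⨁ R (f X k)))
      ≡⟨ ⨁-zero K (λ X X<K → trans (⨁-cong R λ k _ → ⨁-xor R (A₁.column X (odd-number k))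
        (A₅.column X (odd-number k)))
           (trans (⨁-xor R (λ k → ⨁ R (A₁.column X (odd-number k))) (λ k → ⨁ R (A₅.column X (odd-number k))))
             (cong₂ _xor_
             (fixedX-vanishes 1 5 1 0 refl refl (s≤s z≤n) (s≤s z≤n) (0 , refl) (2 , refl) X X<K)
             (fixedX-vanishes 5 1 0 1 refl refl (s≤s z≤n) (s≤s z≤n) (2 , refl) (0 , refl) X X<K)))) ⟩
    false ∎
    where
    open ≡.≡-Reasoning
    f : ℕ → ℕ → ℕ → Bool
    f X k r = A₁.column X (odd-number k) r xor A₅.column X (odd-number k) r

  count : ∀ N → n ≤ N →
    ⨁ (suc N) (λ r → ⨁ (suc N) (λ s → progression (3 * r) 1 s n xor progression (2 + 3 * r) 0 s n))
    ≡ ⨁ (suc N) (λ s → does (2 + 24 * triangle s ≟ n))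
  count N n≤N = begin
    ⨁ (suc N) inner
      ≡⟨ trans (⨁-extend inner-large (s≤s n≤N)) (sym (⨁-extend inner-large (ℕ.<⇒≤ n<R))) ⟩
    ⨁ R inner
      ≡⟨ ⨁-cong R (λ r _ → trans (⨁-xor (suc N) _ _)
           (trans (cong₂ _xor_ (sym (signed-sum (3 * r) 1 n≤N R≥)) (sym (signed-sum (2 + 3 * r) 0 n≤N R≥)))
             (trans (sym (⨁-xor R (signed (suc (2 * (3 * r))) 1) (signed (suc (2 * (2 + 3 * r))) 0)))
               (⨁-cong R λ k _ → cell r k)))) ⟩
    ⨁ R (λ r → ⨁ R (λ k → base k r xor ⨁ K (λ X → A₁.column X (odd-number k) r xor A₅.column X (odd-number k) r)))
      ≡⟨ trans (⨁-cong R λ r _ → ⨁-xor R (λ k → base k r) _) (trans (⨁-xor R (λ r → ⨁ R (λ k → base k r)) _)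
           (trans (cong (⨁ R (λ r → ⨁ R (λ k → base k r)) xor_) columns-vanish) (xor-identityʳ _))) ⟩
    ⨁ R (λ r → ⨁ R (λ k → base k r))
      ≡⟨ ⨁-swap R R (λ r k → base k r) ⟩
    ⨁ R (λ k → ⨁ R (base k))
      ≡⟨ ⨁-cong R (λ k k<R → trans (⨁-single k k<R
        (λ r r≢k → trans (cong (does (suc n ≟ 3 * (odd-number k * odd-number k)) ∧_) (dec-false (r ≟ k) r≢k))
        (∧-zeroʳ _)))
           (trans (cong (does (suc n ≟ 3 * (odd-number k * odd-number k)) ∧_) (dec-true (k ≟ k) refl))
             (∧-identityʳ _))) ⟩
    ⨁ R (λ k → does (suc n ≟ 3 * (odd-number k * odd-number k)))
      ≡⟨ ⨁-cong R (λ k _ → does-⇔ (mk⇔ (λ eq → ℕ.suc-injective (sym (trans eq (three-squares k))))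
        (λ eq → trans (cong suc (sym eq)) (sym (three-squares k)))) (suc n ≟ 3 * (odd-number k * odd-number k))
        (2 + 24 * triangle k ≟ n)) ⟩
    ⨁ R (λ s → does (2 + 24 * triangle s ≟ n))
      ≡⟨ trans (⨁-extend theta-large (ℕ.<⇒≤ n<R)) (sym (⨁-extend theta-large (s≤s n≤N))) ⟩
    ⨁ (suc N) (λ s → does (2 + 24 * triangle s ≟ n)) ∎
    where
    open ≡.≡-Reasoning
    inner : ℕ → Bool
    inner r = ⨁ (suc N) (λ s → progression (3 * r) 1 s n xor progression (2 + 3 * r) 0 s n)
    inner-large : ∀ r → n < r → inner r ≡ false
    inner-large r n<r = ⨁-zero (suc N) λ s _ → cong₂ _xor_
      (progression-large-e (3 * r) 1 s (ℕ.<-≤-trans n<r (ℕ.m≤n*m r 3)))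
      (progression-large-e (2 + 3 * r) 0 s (ℕ.<-≤-trans n<r (ℕ.≤-trans (ℕ.m≤n*m r 3) (ℕ.m≤n+m (3 * r) 2))))
    theta-large : ∀ s → n < s → does (2 + 24 * triangle s ≟ n) ≡ false
    theta-large s n<s = dec-false (2 + 24 * triangle s ≟ n)
      (ℕ.>⇒≢ (ℕ.<-≤-trans n<s (ℕ.≤-trans (triangle-≥ s)
      (ℕ.≤-trans (ℕ.m≤n*m (triangle s) 24) (ℕ.m≤n+m (24 * triangle s) 2)))))
    R≥ : suc n + suc n ≤ R
    R≥ = ℕ.m≤n+m (suc n + suc n) K

counting : ∀ N n → n ≤ N → n % 4 ≡ 2 →
  ⨁ (suc N) (λ r → ⨁ (suc N) (λ s → progression (3 * r) 1 s n xor progression (2 + 3 * r) 0 s n))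
  ≡ ⨁ (suc N) (λ s → does (2 + 24 * triangle s ≟ n))
counting N n n≤N n%4 = Count.count n (n / 4) (trans (m≡m%n+[m/n]*n n 4) (cong (_+ n / 4 * 4) n%4)) N n≤N

-- The congruences modulo 4

ξ-sum-even : ∀ N → N % 4 ≡ 2 → ¬ 48 ∣ N ∸ 2 → 2 ∣ sumTo N (λ k → ξterm k N)
ξ-sum-even N N%4 48∤ = bit-false⇒2∣ (sumTo N (λ k → ξterm k N)) (≡.trans ξ-bit (ξ-sum-vanishes
  (λ i i≤N i%4 → ≡.trans (appell-ψ-at i i≤N) (≡.trans (counting N i i≤N i%4) (≡.sym (ψ⁴-at i i≤N)))) N%4 48∤))
  where open Generating N

one-vanishes : ∀ N → N % 4 ≡ 2 → one N ≡ 0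
one-vanishes (suc N) _ = ≡.refl

pξ-divisible : ∀ N → N % 4 ≡ 2 → ¬ 48 ∣ N ∸ 2 → 4 ∣ pξ N
pξ-divisible N N%4 48∤ = subst (λ x → 4 ∣ x + 2 * sumTo N (λ k → ξterm k N)) (≡.sym (one-vanishes N N%4))
  (*-monoʳ-∣ 2 (ξ-sum-even N N%4 48∤))

theorem5p2 : (n : ℕ) → (4 ∣ pξ (8 * n + 6)) × (4 ∣ pξ (16 * n + 10))
theorem5p2 n =
  pξ-divisible (8 * n + 6)
    (≡.trans (cong (_% 4) (lem₁ n)) ([m+kn]%n≡m%n 6 (2 * n) 4))
    (λ d → contradiction (∣m+n∣m⇒∣n
      (∣-trans (divides 6 ≡.refl) (subst (48 ∣_) (ℕ.+-∸-assoc (8 * n) {6} {2} (s≤s (s≤s z≤n))) d))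
      (m∣m*n {8} n)) (from-no (8 ∣? 4)))
  , pξ-divisible (16 * n + 10)
    (≡.trans (cong (_% 4) (lem₂ n)) ([m+kn]%n≡m%n 10 (4 * n) 4))
    (λ d → contradiction (∣m+n∣m⇒∣n
      (∣-trans (divides 3 ≡.refl) (subst (48 ∣_) (ℕ.+-∸-assoc (16 * n) {10} {2} (s≤s (s≤s z≤n))) d))
      (m∣m*n {16} n)) (from-no (16 ∣? 8)))
  where
  lem₁ : ∀ n → 8 * n + 6 ≡ 6 + 2 * n * 4
  lem₁ = solve-∀
  lem₂ : ∀ n → 16 * n + 10 ≡ 10 + 4 * n * 4
  lem₂ = solve-∀
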